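{- $$\prod_{n=1}^{\infty}\begin{bmatrix}\frac{n}{2(2n+1)} & -\frac{3}{2n(2n+1)} & 0 & \frac{3}{2n^{5}}-\frac{9H_{n-1}^{(4)}}{2n}\\ 0 & \frac{n}{2(2n+1)} & -\frac{3}{2n(2n+1)} & \frac{3}{2n^{3}}\\ 0 & 0 & \frac{n}{2(2n+1)} & \frac{3}{2n}\\ 0 & 0 & 0 & 1\end{bmatrix}=\begin{bmatrix}0 & 0 & 0 & \zeta(6)\\ 0 & 0 & 0 & \zeta(4)\\ 0 & 0 & 0 & \zeta(2)\\ 0 & 0 & 0 & 1\end{bmatrix}.$$
   Context: $\zeta(s)=\sum_{n\geqslant1}n^{ -s}$ is the Riemann zeta function, and $H_{m}^{(4)}=\sum_{j=1}^{m}\frac{1}{j^4}$ with $H_0^{(4)}=0$. The infinite product $\prod_{n=1}^\infty \mathbf{M}_n$ of square matrices means the entrywise limit as $m\to\infty$ of the ordered products $\mathbf{M}_1\mathbf{M}_2\cdots\mathbf{M}_m$ (factors multiplied from left to right in increasing index). -}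

module Defs where

open import Data.Bool.Base using (if_then_else_)
import Data.Fin.Properties as Fin
open import Data.Integer.Base as ℤ using (+_)
import Data.Integer.Properties as ℤ
open import Data.Nat.Base as ℕ using (ℕ; zero; suc; NonZero; NonTrivial)
import Data.Nat.Properties as ℕ
import Data.Nat.Solver as ℕ
open import Data.Product.Base using (_×_; _,_; ∃-syntax)
open import Data.Rational.Base hiding (NonZero)
open import Data.Rational.Properties
open import Data.Rational.Solver using (module +-*-Solver)
import Data.Rational.Unnormalised.Base as ℚᵘ
import Data.Rational.Unnormalised.Properties as ℚᵘ
open import Data.Sum.Base using (inj₁; inj₂)
open import Data.Vec.Functional using (Vector; []; _∷_)
open import Algebra.Properties.CommutativeMonoid.Sum +-0-commutativeMonoid using (sum)
open import Relation.Binary.PropositionalEquality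
open import Relation.Nullary.Decidable.Core using (does)

private
  variable
    p q ε : ℚ

half-pos : 0ℚ < ε → 0ℚ < ½ * ε
half-pos {ε} 0<ε = positive⁻¹ (½ * ε) {{pos*pos⇒pos ½ ε {{positive 0<ε}}}}

half+half : ∀ ε → ½ * ε + ½ * ε ≡ ε
half+half = solve 1 (λ e → con ½ :* e :+ con ½ :* e := e) refl
  where open +-*-Solver

∣∣-sym : ∀ p q → ∣ p - q ∣ ≡ ∣ q - p ∣
∣∣-sym p q = trans (sym (∣-p∣≡∣p∣ (p - q))) (cong ∣_∣ (lemma p q))
  where
  open +-*-Solver
  lemma : ∀ p q → - (p - q) ≡ q - p
  lemma = solve 2 (λ p q → :- (p :- q) := q :- p) refl

p≤r+q⇒p-q≤r : ∀ p q r → p ≤ r + q → p - q ≤ r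
p≤r+q⇒p-q≤r p q r p≤r+q = subst (p - q ≤_) (lemma r q) (+-monoˡ-≤ (- q) p≤r+q)
  where
  open +-*-Solver
  lemma : ∀ r q → r + q - q ≡ r
  lemma = solve 2 (λ r q → r :+ q :- q := r) refl

p≤q⇒0≤q-p : p ≤ q → 0ℚ ≤ q - p
p≤q⇒0≤q-p {p} {q} p≤q = subst (_≤ q - p) (+-inverseʳ p) (+-monoˡ-≤ (- p) p≤q)

∣p∣-∣q∣≤∣p-q∣ : ∀ p q → ∣ p ∣ - ∣ q ∣ ≤ ∣ p - q ∣
∣p∣-∣q∣≤∣p-q∣ p q = p≤r+q⇒p-q≤r (∣ p ∣) (∣ q ∣) (∣ p - q ∣)
  (subst (λ r → ∣ r ∣ ≤ ∣ p - q ∣ + ∣ q ∣) (lemma p q) (∣p+q∣≤∣p∣+∣q∣ (p - q) q))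
  where
  open +-*-Solver
  lemma : ∀ p q → p - q + q ≡ p
  lemma = solve 2 (λ p q → p :- q :+ q := p) refl

∣∣p∣-∣q∣∣≤∣p-q∣ : ∀ p q → ∣ ∣ p ∣ - ∣ q ∣ ∣ ≤ ∣ p - q ∣
∣∣p∣-∣q∣∣≤∣p-q∣ p q with ≤-total (∣ q ∣) (∣ p ∣)
... | inj₁ q≤p = subst (_≤ ∣ p - q ∣) (sym (0≤p⇒∣p∣≡p (p≤q⇒0≤q-p q≤p))) (∣p∣-∣q∣≤∣p-q∣ p q)
... | inj₂ p≤q = subst₂ _≤_
  (trans (sym (0≤p⇒∣p∣≡p (p≤q⇒0≤q-p p≤q))) (∣∣-sym (∣ q ∣) (∣ p ∣)))
  (∣∣-sym q p)
  (∣p∣-∣q∣≤∣p-q∣ q p)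

-- Real numbers are Cauchy sequences of rationals; distinct sequences may
-- represent the same number, so _≡_ on ℝ is not equality of reals.

IsCauchy : (ℕ → ℚ) → Set
IsCauchy a = ∀ ε → 0ℚ < ε → ∃[ N ] ∀ m n → N ℕ.≤ m → N ℕ.≤ n → ∣ a m - a n ∣ < ε

record ℝ : Set where
  constructor mkℝ
  field
    seq      : ℕ → ℚ
    isCauchy : IsCauchy seq

open ℝ public

infix  4 _<ᵣ_ _⟶_
infixl 6 _-ᵣ_

fromℚ : ℚ → ℝ
fromℚ q = mkℝ (λ _ → q) λ ε 0<ε → 0 , λ _ _ _ _ →
  subst (_< ε) (sym (cong ∣_∣ (+-inverseʳ q))) 0<ε

0ᵣ : ℝ
0ᵣ = fromℚ 0ℚ

1ᵣ : ℝ
1ᵣ = fromℚ 1ℚ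

_-ᵣ_ : ℝ → ℝ → ℝ
x -ᵣ y = mkℝ (λ n → seq x n - seq y n) cauchy
  where
  lemma : ∀ a b c d → (a - c) + (d - b) ≡ (a - b) - (c - d)
  lemma = solve 4 (λ a b c d → (a :- c) :+ (d :- b) := (a :- b) :- (c :- d)) refl
    where open +-*-Solver

  cauchy : IsCauchy (λ n → seq x n - seq y n)
  cauchy ε 0<ε with isCauchy x (½ * ε) (half-pos 0<ε) | isCauchy y (½ * ε) (half-pos 0<ε)
  ... | N₁ , h₁ | N₂ , h₂ = N₁ ℕ.⊔ N₂ , λ m n N≤m N≤n →
    let a = seq x m ; b = seq y m ; c = seq x n ; d = seq y n
        open ≤-Reasoning in begin-strict
    ∣ (a - b) - (c - d) ∣   ≡⟨ cong ∣_∣ (lemma a b c d) ⟨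
    ∣ (a - c) + (d - b) ∣   ≤⟨ ∣p+q∣≤∣p∣+∣q∣ (a - c) (d - b) ⟩
    ∣ a - c ∣ + ∣ d - b ∣   <⟨ +-mono-<
                                (h₁ m n (ℕ.m⊔n≤o⇒m≤o N₁ N₂ N≤m) (ℕ.m⊔n≤o⇒m≤o N₁ N₂ N≤n))
                                (h₂ n m (ℕ.m⊔n≤o⇒n≤o N₁ N₂ N≤n) (ℕ.m⊔n≤o⇒n≤o N₁ N₂ N≤m)) ⟩
    ½ * ε + ½ * ε           ≡⟨ half+half ε ⟩
    ε                       ∎

∣_∣ᵣ : ℝ → ℝ
∣ x ∣ᵣ = mkℝ (λ n → ∣ seq x n ∣) λ ε 0<ε →
  let N , h = isCauchy x ε 0<ε in
  N , λ m n N≤m N≤n → ≤-<-trans (∣∣p∣-∣q∣∣≤∣p-q∣ (seq x m) (seq x n)) (h m n N≤m N≤n)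

_<ᵣ_ : ℝ → ℝ → Set
x <ᵣ y = ∃[ δ ] 0ℚ < δ × ∃[ N ] ∀ n → N ℕ.≤ n → seq x n + δ ≤ seq y n

_⟶_ : (ℕ → ℝ) → ℝ → Set
a ⟶ x = ∀ ε → 0ᵣ <ᵣ ε → ∃[ N ] ∀ m → N ℕ.≤ m → ∣ a m -ᵣ x ∣ᵣ <ᵣ ε

-- A real number is the limit of any rational sequence representing it.
seq⟶ : ∀ x → (λ m → fromℚ (seq x m)) ⟶ x
seq⟶ x ε (δ , 0<δ , N₁ , h₁) with isCauchy x (½ * δ) (half-pos 0<δ)
... | N₂ , h₂ = N₂ , λ m N₂≤m → ½ * δ , half-pos 0<δ , N₁ ℕ.⊔ N₂ , λ n N≤n →
  let open ≤-Reasoning in begin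
  ∣ seq x m - seq x n ∣ + ½ * δ   ≤⟨ +-monoˡ-≤ (½ * δ)
                                      (<⇒≤ (h₂ m n N₂≤m (ℕ.m⊔n≤o⇒n≤o N₁ N₂ N≤n))) ⟩
  ½ * δ + ½ * δ                   ≡⟨ half+half δ ⟩
  δ                               ≡⟨ +-identityˡ δ ⟨
  0ℚ + δ                          ≤⟨ h₁ n (ℕ.m⊔n≤o⇒m≤o N₁ N₂ N≤n) ⟩
  seq ε n                         ∎

-- H s m = ∑_{j=1}^{m} 1 / j^s
H : ℕ → ℕ → ℚ
H s zero    = 0ℚ
H s (suc m) = H s m + (+ 1 / suc m ℕ.^ s) {{ℕ.m^n≢0 (suc m) s}}

recip-anti : ∀ c d .{{_ : NonZero c}} .{{_ : NonZero d}} → c ℕ.≤ d → + 1 / d ≤ + 1 / c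
recip-anti (suc c) (suc d) c≤d = toℚᵘ-cancel-≤ (begin
  toℚᵘ (+ 1 / suc d)   ≃⟨ toℚᵘ-fromℚᵘ (ℚᵘ.mkℚᵘ (+ 1) d) ⟩
  ℚᵘ.mkℚᵘ (+ 1) d      ≤⟨ ℚᵘ.*≤* (ℤ.*-monoˡ-≤-nonNeg (+ 1) (ℤ.+≤+ c≤d)) ⟩
  ℚᵘ.mkℚᵘ (+ 1) c      ≃⟨ toℚᵘ-fromℚᵘ (ℚᵘ.mkℚᵘ (+ 1) c) ⟨
  toℚᵘ (+ 1 / suc c)   ∎)
  where open ℚᵘ.≤-Reasoning

recip-nonNeg : ∀ d .{{_ : NonZero d}} → 0ℚ ≤ + 1 / d
recip-nonNeg d = nonNegative⁻¹ (+ 1 / d) {{normalize-nonNeg 1 d}}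

archimedean : ∀ ε → 0ℚ < ε → ∃[ k ] + 1 / suc k < ε
archimedean ε@(mkℚ (+ suc a) d _) _ = suc d , toℚᵘ-cancel-< (begin-strict
  toℚᵘ (+ 1 / suc (suc d))   ≃⟨ toℚᵘ-fromℚᵘ (ℚᵘ.mkℚᵘ (+ 1) (suc d)) ⟩
  ℚᵘ.mkℚᵘ (+ 1) (suc d)      <⟨ ℚᵘ.*<* (ℤ.+<+ lemma) ⟩
  toℚᵘ ε                     ∎)
  where
  open ℚᵘ.≤-Reasoning
  lemma : 1 ℕ.* suc d ℕ.< suc a ℕ.* suc (suc d)
  lemma = ℕ.<-≤-trans (ℕ.*-monoʳ-< 1 (ℕ.n<1+n (suc d)))
                      (ℕ.*-monoˡ-≤ (suc (suc d)) {1} {suc a} (ℕ.s≤s ℕ.z≤n))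
archimedean (mkℚ (+ zero) _ _) (*<* (ℤ.+<+ ()))
archimedean (mkℚ ℤ.-[1+ _ ] _ _) (*<* ())

telescope : ∀ m → + 1 / (suc m ℕ.* suc (suc m)) + + 1 / suc (suc m) ≡ + 1 / suc m
telescope m = toℚᵘ-injective (begin
  toℚᵘ (x + y)             ≈⟨ toℚᵘ-homo-+ x y ⟩
  toℚᵘ x ℚᵘ.+ toℚᵘ y       ≈⟨ ℚᵘ.+-cong (toℚᵘ-fromℚᵘ x′) (toℚᵘ-fromℚᵘ y′) ⟩
  x′ ℚᵘ.+ y′               ≈⟨ ℚᵘ.*≡* (cong +_ (lemma m)) ⟩
  ℚᵘ.mkℚᵘ (+ 1) m          ≈⟨ toℚᵘ-fromℚᵘ (ℚᵘ.mkℚᵘ (+ 1) m) ⟨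
  toℚᵘ (+ 1 / suc m)       ∎)
  where
  open import Relation.Binary.Reasoning.Setoid ℚᵘ.≃-setoid
  x y : ℚ
  x = + 1 / (suc m ℕ.* suc (suc m))
  y = + 1 / suc (suc m)
  x′ y′ : ℚᵘ.ℚᵘ
  x′ = + 1 ℚᵘ./ (suc m ℕ.* suc (suc m))
  y′ = + 1 ℚᵘ./ suc (suc m)
  lemma : ∀ m → (1 ℕ.* suc (suc m) ℕ.+ 1 ℕ.* (suc m ℕ.* suc (suc m))) ℕ.* suc m
              ≡ 1 ℕ.* ((suc m ℕ.* suc (suc m)) ℕ.* suc (suc m))
  lemma = solve 1 (λ m → let a = con 1 :+ m ; b = con 2 :+ m in
    (con 1 :* b :+ con 1 :* (a :* b)) :* a := con 1 :* ((a :* b) :* b)) refl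
    where open ℕ.+-*-Solver

H-step : ∀ s m → H s m ≤ H s (suc m)
H-step s m = subst (_≤ H s (suc m)) (+-identityʳ (H s m))
  (+-monoʳ-≤ (H s m) (recip-nonNeg (suc m ℕ.^ s) {{ℕ.m^n≢0 (suc m) s}}))

H-mono′ : ∀ s n k → H s n ≤ H s (k ℕ.+ n)
H-mono′ s n zero    = ≤-refl
H-mono′ s n (suc k) = ≤-trans (H-mono′ s n k) (H-step s (k ℕ.+ n))

module _ (s : ℕ) .{{_ : NonTrivial s}} where

  U : ℕ → ℚ
  U m = + 1 / suc m + H s (suc m)

  U-step : ∀ m → U (suc m) ≤ U m
  U-step m = begin
    v + (h + w)   ≡⟨ rearrange v h w ⟩
    (w + v) + h   ≤⟨ +-monoˡ-≤ h (+-monoˡ-≤ v w≤) ⟩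
    (+ 1 / (suc m ℕ.* suc (suc m)) + v) + h   ≡⟨ cong (_+ h) (telescope m) ⟩
    + 1 / suc m + h   ∎
    where
    open ≤-Reasoning
    v h w : ℚ
    v = + 1 / suc (suc m)
    h = H s (suc m)
    w = (+ 1 / suc (suc m) ℕ.^ s) {{ℕ.m^n≢0 (suc (suc m)) s}}
    rearrange : ∀ v h w → v + (h + w) ≡ (w + v) + h
    rearrange = solve 3 (λ v h w → v :+ (h :+ w) := (w :+ v) :+ h) refl
      where open +-*-Solver
    pow : suc m ℕ.* suc (suc m) ℕ.≤ suc (suc m) ℕ.^ s
    pow = ℕ.≤-trans
      (subst (suc m ℕ.* suc (suc m) ℕ.≤_)
        (cong (suc (suc m) ℕ.*_) (sym (ℕ.*-identityʳ (suc (suc m)))))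
        (ℕ.*-monoˡ-≤ (suc (suc m)) (ℕ.n≤1+n (suc m))))
      (ℕ.^-monoʳ-≤ (suc (suc m)) (ℕ.nonTrivial⇒n>1 s))
    w≤ : w ≤ + 1 / (suc m ℕ.* suc (suc m))
    w≤ = recip-anti (suc m ℕ.* suc (suc m)) (suc (suc m) ℕ.^ s)
           {{_}} {{ℕ.m^n≢0 (suc (suc m)) s}} pow

  U-anti : ∀ n k → U (k ℕ.+ n) ≤ U n
  U-anti n zero    = ≤-refl
  U-anti n (suc k) = ≤-trans (U-step (k ℕ.+ n)) (U-anti n k)

  H≤U : ∀ n m → H s m ≤ U n
  H≤U n m = ≤-trans (H-mono′ s m (suc n)) (≤-trans H≤ (U-anti n m))
    where
    H≤ : H s (suc n ℕ.+ m) ≤ U (m ℕ.+ n)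
    H≤ = subst (λ k → H s (suc k) ≤ U (m ℕ.+ n)) (ℕ.+-comm m n)
      (subst (_≤ U (m ℕ.+ n)) (+-identityˡ _)
        (+-monoˡ-≤ (H s (suc (m ℕ.+ n))) (recip-nonNeg (suc (m ℕ.+ n)))))

  H-mono : ∀ {n m} → n ℕ.≤ m → H s n ≤ H s m
  H-mono {n} {m} n≤m = subst (λ k → H s n ≤ H s k) (ℕ.m∸n+n≡m n≤m) (H-mono′ s n (m ℕ.∸ n))

  H-tail : ∀ N m n → suc N ℕ.≤ n → H s m - H s n ≤ + 1 / suc N
  H-tail N m n N<n = p≤r+q⇒p-q≤r (H s m) (H s n) (+ 1 / suc N)
    (≤-trans (H≤U N m) (+-monoʳ-≤ (+ 1 / suc N) (H-mono N<n)))

  H-close : ∀ N m n → suc N ℕ.≤ m → suc N ℕ.≤ n → ∣ H s m - H s n ∣ ≤ + 1 / suc N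
  H-close N m n N<m N<n with ℕ.≤-total n m
  ... | inj₁ n≤m = subst (_≤ + 1 / suc N)
    (sym (0≤p⇒∣p∣≡p (p≤q⇒0≤q-p (H-mono n≤m)))) (H-tail N m n N<n)
  ... | inj₂ m≤n = subst (_≤ + 1 / suc N)
    (trans (sym (0≤p⇒∣p∣≡p (p≤q⇒0≤q-p (H-mono m≤n)))) (∣∣-sym (H s n) (H s m)))
    (H-tail N n m N<m)

H-isCauchy : ∀ s .{{_ : NonTrivial s}} → IsCauchy (H s)
H-isCauchy s ε 0<ε with archimedean ε 0<ε
... | N , 1/N<ε = suc N , λ m n N<m N<n → ≤-<-trans (H-close s N m n N<m N<n) 1/N<ε

-- The limit of the partial sums of ∑ n^{-s} (see seq⟶), for integers s ≥ 2.
ζ : (s : ℕ) .{{_ : NonTrivial s}} → ℝ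
ζ s = mkℝ (H s) (H-isCauchy s)

Matrix : Set → ℕ → Set
Matrix A k = Vector (Vector A k) k

identity : ∀ {k} → Matrix ℚ k
identity i j = if does (i Fin.≟ j) then 1ℚ else 0ℚ

infixl 7 _⊗_

_⊗_ : ∀ {k} → Matrix ℚ k → Matrix ℚ k → Matrix ℚ k
(A ⊗ B) i j = sum (λ l → A i l * B l j)

-- partialProduct M m = M 1 ⊗ M 2 ⊗ ⋯ ⊗ M m
partialProduct : ∀ {k} → ((n : ℕ) .{{_ : NonZero n}} → Matrix ℚ k) → ℕ → Matrix ℚ k
partialProduct M zero    = identity
partialProduct M (suc m) = partialProduct M m ⊗ M (suc m)

infix 4 ∏∞_≈_

∏∞_≈_ : ∀ {k} → ((n : ℕ) .{{_ : NonZero n}} → Matrix ℚ k) → Matrix ℝ k → Set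
∏∞ M ≈ L = ∀ i j → (λ m → fromℚ (partialProduct M m i j)) ⟶ L i j

factor : (n : ℕ) .{{_ : NonZero n}} → Matrix ℚ 4
factor n@(suc n-1) =
    (a  ∷ b  ∷ 0ℚ ∷ + 3 / (2 ℕ.* n ℕ.^ 5) - + 9 / (2 ℕ.* n) * H 4 n-1 ∷ [])
  ∷ (0ℚ ∷ a  ∷ b  ∷ + 3 / (2 ℕ.* n ℕ.^ 3)                             ∷ [])
  ∷ (0ℚ ∷ 0ℚ ∷ a  ∷ + 3 / (2 ℕ.* n)                                   ∷ [])
  ∷ (0ℚ ∷ 0ℚ ∷ 0ℚ ∷ 1ℚ                                                ∷ [])
  ∷ []
  where
  a b : ℚ
  a = + n / (2 ℕ.* (2 ℕ.* n ℕ.+ 1))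
  b = - (+ 3 / (2 ℕ.* n ℕ.* (2 ℕ.* n ℕ.+ 1)))

limit : Matrix ℝ 4
limit =
    (0ᵣ ∷ 0ᵣ ∷ 0ᵣ ∷ ζ 6 ∷ [])
  ∷ (0ᵣ ∷ 0ᵣ ∷ 0ᵣ ∷ ζ 4 ∷ [])
  ∷ (0ᵣ ∷ 0ᵣ ∷ 0ᵣ ∷ ζ 2 ∷ [])
  ∷ (0ᵣ ∷ 0ᵣ ∷ 0ᵣ ∷ 1ᵣ  ∷ [])
  ∷ []

{-# OPTIONS --safe #-}

-- Over ℚ[y]/(y³) the factors become scalars: the upper 3 × 3 Toeplitz blocks form this ring, and the
-- last column of M₁ ⋯ Mₘ is read as an element of it.  That column turns out to be the m-th partial
-- sum of the Bailey–Borwein–Bradley series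
--   3 ∑ₙ 1 / (C(2n,n) (n² - y)) ∏_{j<n} (j² - 4y) / (j² - y)  =  ∑ₖ 1 / (k² - y),
-- taken modulo y³, and the coefficients on the right are ζ(2), ζ(4), ζ(6).  The series identity comes
-- from a WZ pair F, G with F 0 k = 1 / ((k+1)² - y): summing
--   F (n+1) k - F n k = G n (k+1) - G n k
-- over a rectangle gives an exact error term for the partial sums, which is small in the
-- submultiplicative norm ∣c₀∣ + ½ ∣c₁∣ + ¼ ∣c₂∣, as ‖ F (n+1) k ‖ ≤ ½ ‖ F n k ‖.
module Submission where

open import Defs

import Algebra.Consequences.Propositional as Propositional
import Algebra.Consequences.Setoid as Setoid
open import Algebra.Bundles using (CommutativeRing)
open import Data.Rational.Properties
open import Algebra.Properties.CommutativeMonoid.Sum +-0-commutativeMonoid using (sum-cong-≗)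
open import Algebra.Properties.Semiring.Exp (CommutativeRing.semiring +-*-commutativeRing) using (_^_)
open import Algebra.Solver.Ring.AlmostCommutativeRing using (fromCommutativeRing)
import Algebra.Solver.Ring.Simple
open import Data.Fin.Patterns using (0F; 1F; 2F; 3F)
open import Data.Integer.Base as ℤ using (+_)
import Data.Integer.Properties as ℤ
import Data.Integer.Solver as ℤ
open import Data.Nat.Base as ℕ using (ℕ; zero; suc; NonZero)
import Data.Nat.Properties as ℕ
open import Data.Product.Base using (_,_; ∃-syntax; proj₁; proj₂)
open import Data.Rational.Base hiding (NonZero)
open import Data.Rational.Solver using (module +-*-Solver)
import Data.Rational.Unnormalised.Base as ℚᵘ
import Data.Rational.Unnormalised.Properties as ℚᵘ
open import Data.Vec.Functional using ([]; _∷_)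
open import Level using (0ℓ)
open import Relation.Binary.Definitions using (DecidableEquality)
open import Relation.Binary.PropositionalEquality
import Relation.Binary.Reasoning.Setoid as SetoidReasoning
open import Relation.Nullary.Decidable using (from-yes; map′; _×-dec_)

-- The ring ℚ[y]/(y³)

-- ⟨ a , b , c ⟩ is a + b y + c y² in ℚ[y]/(y³).
record Jet : Set where
  constructor ⟨_,_,_⟩
  field
    coeff₀ coeff₁ coeff₂ : ℚ
open Jet

infixl 7 _*ⱼ_
infixl 6 _+ⱼ_

_+ⱼ_ _*ⱼ_ : Jet → Jet → Jet
⟨ a , b , c ⟩ +ⱼ ⟨ a′ , b′ , c′ ⟩ = ⟨ a + a′ , b + b′ , c + c′ ⟩
⟨ a , b , c ⟩ *ⱼ ⟨ a′ , b′ , c′ ⟩ =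
  ⟨ a * a′ , a * b′ + b * a′ , a * c′ + b * b′ + c * a′ ⟩

negⱼ : Jet → Jet
negⱼ ⟨ a , b , c ⟩ = ⟨ - a , - b , - c ⟩

infixl 6 _-ⱼ_

_-ⱼ_ : Jet → Jet → Jet
p -ⱼ q = p +ⱼ negⱼ q

ι : ℚ → Jet
ι q = ⟨ q , 0ℚ , 0ℚ ⟩

0ⱼ 1ⱼ y : Jet
0ⱼ = ι 0ℚ
1ⱼ = ι 1ℚ
y  = ⟨ 0ℚ , 1ℚ , 0ℚ ⟩

jet-≡ : ∀ {a b c a′ b′ c′} → a ≡ a′ → b ≡ b′ → c ≡ c′ → ⟨ a , b , c ⟩ ≡ ⟨ a′ , b′ , c′ ⟩
jet-≡ refl refl refl = refl

infix 4 _≟ⱼ_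

-- The ring solver compares its constants, and these are themselves jets, so equality has to be
-- decidable on all of `Jet`.
_≟ⱼ_ : DecidableEquality Jet
⟨ a , b , c ⟩ ≟ⱼ ⟨ a′ , b′ , c′ ⟩ =
  map′ (λ (p , q , r) → jet-≡ p q r)
       (λ e → cong coeff₀ e , cong coeff₁ e , cong coeff₂ e)
       (a ≟ a′ ×-dec b ≟ b′ ×-dec c ≟ c′)

module _ where
  open +-*-Solver

  *ⱼ-assoc : ∀ p q r → (p *ⱼ q) *ⱼ r ≡ p *ⱼ (q *ⱼ r)
  *ⱼ-assoc ⟨ a , b , c ⟩ ⟨ a′ , b′ , c′ ⟩ ⟨ a″ , b″ , c″ ⟩ = jet-≡
    (*-assoc a a′ a″)
    (solve 6 (λ a b a′ b′ a″ b″ →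
      a :* a′ :* b″ :+ (a :* b′ :+ b :* a′) :* a″ :=
      a :* (a′ :* b″ :+ b′ :* a″) :+ b :* (a′ :* a″)) refl a b a′ b′ a″ b″)
    (solve 9 (λ a b c a′ b′ c′ a″ b″ c″ →
      a :* a′ :* c″ :+ (a :* b′ :+ b :* a′) :* b″ :+ (a :* c′ :+ b :* b′ :+ c :* a′) :* a″ :=
      a :* (a′ :* c″ :+ b′ :* b″ :+ c′ :* a″) :+ b :* (a′ :* b″ :+ b′ :* a″) :+ c :* (a′ :* a″))
      refl a b c a′ b′ c′ a″ b″ c″)

  *ⱼ-comm : ∀ p q → p *ⱼ q ≡ q *ⱼ p
  *ⱼ-comm ⟨ a , b , c ⟩ ⟨ a′ , b′ , c′ ⟩ = jet-≡
    (*-comm a a′)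
    (solve 4 (λ a b a′ b′ → a :* b′ :+ b :* a′ := a′ :* b :+ b′ :* a) refl a b a′ b′)
    (solve 6 (λ a b c a′ b′ c′ →
      a :* c′ :+ b :* b′ :+ c :* a′ := a′ :* c :+ b′ :* b :+ c′ :* a) refl a b c a′ b′ c′)

  *ⱼ-identityˡ : ∀ p → 1ⱼ *ⱼ p ≡ p
  *ⱼ-identityˡ ⟨ a , b , c ⟩ = jet-≡
    (*-identityˡ a)
    (solve 2 (λ a b → con 1ℚ :* b :+ con 0ℚ :* a := b) refl a b)
    (solve 3 (λ a b c → con 1ℚ :* c :+ con 0ℚ :* b :+ con 0ℚ :* a := c) refl a b c)

  *ⱼ-distribˡ-+ⱼ : ∀ p q r → p *ⱼ (q +ⱼ r) ≡ p *ⱼ q +ⱼ p *ⱼ r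
  *ⱼ-distribˡ-+ⱼ ⟨ a , b , c ⟩ ⟨ a′ , b′ , c′ ⟩ ⟨ a″ , b″ , c″ ⟩ = jet-≡
    (*-distribˡ-+ a a′ a″)
    (solve 6 (λ a b a′ b′ a″ b″ →
      a :* (b′ :+ b″) :+ b :* (a′ :+ a″) := a :* b′ :+ b :* a′ :+ (a :* b″ :+ b :* a″))
      refl a b a′ b′ a″ b″)
    (solve 9 (λ a b c a′ b′ c′ a″ b″ c″ →
      a :* (c′ :+ c″) :+ b :* (b′ :+ b″) :+ c :* (a′ :+ a″) :=
      a :* c′ :+ b :* b′ :+ c :* a′ :+ (a :* c″ :+ b :* b″ :+ c :* a″))
      refl a b c a′ b′ c′ a″ b″ c″)

jetRing : CommutativeRing 0ℓ 0ℓ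
jetRing = record
  { Carrier = Jet ; _≈_ = _≡_ ; _+_ = _+ⱼ_ ; _*_ = _*ⱼ_ ; -_ = negⱼ ; 0# = 0ⱼ ; 1# = 1ⱼ
  ; isCommutativeRing = record
    { isRing = record
      { +-isAbelianGroup = record
        { isGroup = record
          { isMonoid = record
            { isSemigroup = record
              { isMagma = record { isEquivalence = isEquivalence ; ∙-cong = cong₂ _+ⱼ_ }
              ; assoc = λ { ⟨ a , b , c ⟩ ⟨ a′ , b′ , c′ ⟩ ⟨ a″ , b″ , c″ ⟩ →
                  jet-≡ (+-assoc a a′ a″) (+-assoc b b′ b″) (+-assoc c c′ c″) }
              }
            ; identity = (λ p → jet-≡ (+-identityˡ _) (+-identityˡ _) (+-identityˡ _))
                       , (λ p → jet-≡ (+-identityʳ _) (+-identityʳ _) (+-identityʳ _))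
            }
          ; inverse = (λ { ⟨ a , b , c ⟩ → jet-≡ (+-inverseˡ a) (+-inverseˡ b) (+-inverseˡ c) })
                    , (λ { ⟨ a , b , c ⟩ → jet-≡ (+-inverseʳ a) (+-inverseʳ b) (+-inverseʳ c) })
          ; ⁻¹-cong = cong negⱼ
          }
        ; comm = λ p q → jet-≡ (+-comm (coeff₀ p) _) (+-comm (coeff₁ p) _) (+-comm (coeff₂ p) _)
        }
      ; *-cong = cong₂ _*ⱼ_
      ; *-assoc = *ⱼ-assoc
      ; *-identity = Propositional.comm∧idˡ⇒id *ⱼ-comm *ⱼ-identityˡ
      ; distrib = Setoid.comm∧distrˡ⇒distr (setoid Jet) (cong₂ _+ⱼ_) *ⱼ-comm *ⱼ-distribˡ-+ⱼ
      }
    ; *-comm = *ⱼ-comm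
    }
  }

module JetSolver = Algebra.Solver.Ring.Simple (fromCommutativeRing jetRing) _≟ⱼ_

-- Natural numbers and their reciprocals in ℚ

ν : ℕ → ℚ
ν zero    = 0ℚ
ν (suc n) = 1ℚ + ν n

ν-+ : ∀ m n → ν (m ℕ.+ n) ≡ ν m + ν n
ν-+ zero    n = sym (+-identityˡ (ν n))
ν-+ (suc m) n = trans (cong (λ z → 1ℚ + z) (ν-+ m n)) (sym (+-assoc 1ℚ (ν m) (ν n)))

-- On ℚ, `_/_` cancels common factors and so does not reduce on variables; in ℚᵘ the claim is a
-- polynomial identity over ℤ.
suc/ : ∀ m n .{{_ : NonZero n}} → + suc m / n ≡ + 1 / n + + m / n
suc/ m n@(suc k) = toℚᵘ-injective (begin
  toℚᵘ (+ suc m / n)                     ≈⟨ toℚᵘ-fromℚᵘ (ℚᵘ.mkℚᵘ (+ suc m) k) ⟩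
  ℚᵘ.mkℚᵘ (+ suc m) k                    ≈⟨ ℚᵘ.*≡* (lemma (+ m) (+ n)) ⟩
  ℚᵘ.mkℚᵘ (+ 1) k ℚᵘ.+ ℚᵘ.mkℚᵘ (+ m) k
    ≈⟨ ℚᵘ.+-cong (toℚᵘ-fromℚᵘ (ℚᵘ.mkℚᵘ (+ 1) k)) (toℚᵘ-fromℚᵘ (ℚᵘ.mkℚᵘ (+ m) k)) ⟨
  toℚᵘ (+ 1 / n) ℚᵘ.+ toℚᵘ (+ m / n)     ≈⟨ toℚᵘ-homo-+ (+ 1 / n) (+ m / n) ⟨
  toℚᵘ (+ 1 / n + + m / n)               ∎)
  where
  open SetoidReasoning ℚᵘ.≃-setoid
  open ℤ.+-*-Solver
  lemma : ∀ m n → (+ 1 ℤ.+ m) ℤ.* (n ℤ.* n) ≡ (+ 1 ℤ.* n ℤ.+ m ℤ.* n) ℤ.* n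
  lemma = solve 2 (λ m n → (con (+ 1) :+ m) :* (n :* n) := (con (+ 1) :* n :+ m :* n) :* n) refl

-- Brings the entries of `factor` into the form of products of numerators and unit fractions, to
-- which the ring solver applies.
/≡ν*recip : ∀ m n .{{_ : NonZero n}} → + m / n ≡ ν m * (+ 1 / n)
/≡ν*recip zero    (suc n) = trans
  (toℚᵘ-injective (ℚᵘ.≃-trans (toℚᵘ-fromℚᵘ (ℚᵘ.mkℚᵘ (+ 0) n)) (ℚᵘ.*≡* refl)))
  (sym (*-zeroˡ (+ 1 / suc n)))
/≡ν*recip (suc m) n = begin
  + suc m / n                            ≡⟨ suc/ m n ⟩
  + 1 / n + + m / n
    ≡⟨ cong₂ _+_ (sym (*-identityˡ (+ 1 / n))) (/≡ν*recip m n) ⟩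
  1ℚ * (+ 1 / n) + ν m * (+ 1 / n)       ≡⟨ *-distribʳ-+ (+ 1 / n) 1ℚ (ν m) ⟨
  ν (suc m) * (+ 1 / n)                  ∎
  where open ≡-Reasoning

recip-* : ∀ m n .{{_ : NonZero m}} .{{_ : NonZero n}} .{{_ : NonZero (m ℕ.* n)}} →
          + 1 / (m ℕ.* n) ≡ (+ 1 / m) * (+ 1 / n)
recip-* m@(suc a) n@(suc b) = toℚᵘ-injective (begin
  toℚᵘ (+ 1 / (m ℕ.* n))                 ≈⟨ toℚᵘ-fromℚᵘ (+ 1 ℚᵘ./ (m ℕ.* n)) ⟩
  ℚᵘ.mkℚᵘ (+ 1) a ℚᵘ.* ℚᵘ.mkℚᵘ (+ 1) b
    ≈⟨ ℚᵘ.*-cong (toℚᵘ-fromℚᵘ (ℚᵘ.mkℚᵘ (+ 1) a)) (toℚᵘ-fromℚᵘ (ℚᵘ.mkℚᵘ (+ 1) b)) ⟨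
  toℚᵘ (+ 1 / m) ℚᵘ.* toℚᵘ (+ 1 / n)     ≈⟨ toℚᵘ-homo-* (+ 1 / m) (+ 1 / n) ⟨
  toℚᵘ ((+ 1 / m) * (+ 1 / n))           ∎)
  where open SetoidReasoning ℚᵘ.≃-setoid

-- Note the shift: inv n is 1 / (n + 1).
inv : ℕ → ℚ
inv n = + 1 / suc n

ν*inv : ∀ n → ν (suc n) * inv n ≡ 1ℚ
ν*inv n = trans (sym (/≡ν*recip (suc n) (suc n))) (toℚᵘ-injective
  (ℚᵘ.≃-trans (toℚᵘ-fromℚᵘ (ℚᵘ.mkℚᵘ (+ suc n) n)) (ℚᵘ.*≡* (ℤ.*-comm (+ suc n) (+ 1)))))

recip-^ : ∀ n s .{{_ : NonZero (suc n ℕ.^ s)}} → + 1 / (suc n ℕ.^ s) ≡ inv n ^ s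
recip-^ n zero    = refl
recip-^ n (suc s) = trans
  (recip-* (suc n) (suc n ℕ.^ s) {{_}} {{ℕ.m^n≢0 (suc n) s}})
  (cong (inv n *_) (recip-^ n s {{ℕ.m^n≢0 (suc n) s}}))

2ℚ 3ℚ 4ℚ : ℚ
2ℚ = + 2 / 1
3ℚ = + 3 / 1
4ℚ = + 4 / 1

-- 1 / (2 (2n + 1))
d : ℕ → ℚ
d n = ½ * inv (2 ℕ.* n)

2ⱼ 3ⱼ 4ⱼ : Jet
2ⱼ = ι 2ℚ
3ⱼ = ι 3ℚ
4ⱼ = ι 4ℚ

ι-* : ∀ a b → ι a *ⱼ ι b ≡ ι (a * b)
ι-* a b = jet-≡ refl
  (solve 2 (λ a b → a :* con 0ℚ :+ con 0ℚ :* b := con 0ℚ) refl a b)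
  (solve 2 (λ a b → a :* con 0ℚ :+ con 0ℚ :* con 0ℚ :+ con 0ℚ :* b := con 0ℚ) refl a b)
  where open +-*-Solver

-- Stated for jets because the WZ identity needs it there; its `coeff₀` is the rational identity 2
-- (2n + 1) d(n) = 1 used in the estimates.
d-inverse : ∀ n → 2ⱼ *ⱼ (1ⱼ +ⱼ 2ⱼ *ⱼ ι (ν n)) *ⱼ ι (d n) ≡ 1ⱼ
d-inverse n = begin
  2ⱼ *ⱼ (1ⱼ +ⱼ 2ⱼ *ⱼ ι (ν n)) *ⱼ ι (d n)
    ≡⟨ cong (λ z → 2ⱼ *ⱼ (1ⱼ +ⱼ z) *ⱼ ι (d n)) (ι-* 2ℚ (ν n)) ⟩
  2ⱼ *ⱼ ι (1ℚ + 2ℚ * ν n) *ⱼ ι (d n)       ≡⟨ cong (_*ⱼ ι (d n)) (ι-* 2ℚ (1ℚ + 2ℚ * ν n)) ⟩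
  ι (2ℚ * (1ℚ + 2ℚ * ν n)) *ⱼ ι (d n)      ≡⟨ ι-* (2ℚ * (1ℚ + 2ℚ * ν n)) (d n) ⟩
  ι (2ℚ * (1ℚ + 2ℚ * ν n) * (½ * w))       ≡⟨ cong ι (lemma (ν n) w) ⟩
  -- The 0ℚ mirrors the unfolding of `2 ℕ.* n` to `n ℕ.+ (n ℕ.+ 0)`.
  ι ((1ℚ + (ν n + (ν n + 0ℚ))) * w)        ≡⟨ cong (λ z → ι ((1ℚ + (ν n + z)) * w)) (ν-+ n 0) ⟨
  ι ((1ℚ + (ν n + ν (n ℕ.+ 0))) * w)       ≡⟨ cong (λ z → ι ((1ℚ + z) * w)) (ν-+ n (n ℕ.+ 0)) ⟨
  ι (ν (suc (2 ℕ.* n)) * w)                ≡⟨ cong ι (ν*inv (2 ℕ.* n)) ⟩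
  1ⱼ                                       ∎
  where
  open ≡-Reasoning
  open +-*-Solver
  w : ℚ
  w = inv (2 ℕ.* n)
  lemma : ∀ n w → 2ℚ * (1ℚ + 2ℚ * n) * (½ * w) ≡ (1ℚ + (n + (n + 0ℚ))) * w
  lemma = solve 2 (λ n w → con 2ℚ :* (con 1ℚ :+ con 2ℚ :* n) :* (con ½ :* w)
                        := (con 1ℚ :+ (n :+ (n :+ con 0ℚ))) :* w) refl

-- Quadratic factors and the WZ pair

-- (j + 1)² - c y
quad : ℚ → ℕ → Jet
quad c j = ι (ν (suc j)) *ⱼ ι (ν (suc j)) -ⱼ ι c *ⱼ y

-- 1 / ((j + 1)² - y)
I : ℕ → Jet
I j = ⟨ inv j ^ 2 , inv j ^ 4 , inv j ^ 6 ⟩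

quad-≡ : ∀ c j → quad c j ≡ ⟨ ν (suc j) * ν (suc j) , - c , 0ℚ ⟩
quad-≡ c j = jet-≡
  (solve 2 (λ v c → v :* v :- c :* con 0ℚ := v :* v) refl (ν (suc j)) c)
  (solve 2 (λ v c → v :* con 0ℚ :+ con 0ℚ :* v :- (c :* con 1ℚ :+ con 0ℚ :* con 0ℚ) := :- c)
    refl (ν (suc j)) c)
  (solve 2 (λ v c → v :* con 0ℚ :+ con 0ℚ :* con 0ℚ :+ con 0ℚ :* v
      :- (c :* con 0ℚ :+ con 0ℚ :* con 1ℚ :+ con 0ℚ :* con 0ℚ) := con 0ℚ)
    refl (ν (suc j)) c)
  where open +-*-Solver

-- With v = j + 1, v² - c y = (v² - y) + (1 - c) y, so the quotient by v² - y is 1 + (1 - c) y / (v²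
-- - y). The case c = 1 makes `I` an inverse; c = 4 gives the ratios in the series.
quad*I : ∀ c j → quad c j *ⱼ I j ≡ ⟨ 1ℚ , (1ℚ - c) * inv j ^ 2 , (1ℚ - c) * inv j ^ 4 ⟩
quad*I c j = begin
  quad c j *ⱼ I j                                          ≡⟨ cong (_*ⱼ I j) (quad-≡ c j) ⟩
  ⟨ v * v , - c , 0ℚ ⟩ *ⱼ I j                              ≡⟨ jet-≡ (l₀ v u) (l₁ c v u) (l₂ c v u) ⟩
  jet (v * u)                                              ≡⟨ cong jet (ν*inv j) ⟩
  jet 1ℚ ∎
  where
  open ≡-Reasoning
  open +-*-Solver
  u v : ℚ
  u = inv j
  v = ν (suc j)
  -- The argument t stands for v u. The solver does not know that v u = 1, so this product is
  -- isolated and replaced in all coefficients at once.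
  jet : ℚ → Jet
  jet t = ⟨ t * t , (t * t - c) * u ^ 2 , (t * t - c) * u ^ 4 ⟩
  l₀ : ∀ v u → v * v * u ^ 2 ≡ v * u * (v * u)
  l₀ = solve 2 (λ v u → v :* v :* u :^ 2 := v :* u :* (v :* u)) refl
  l₁ : ∀ c v u → v * v * u ^ 4 + - c * u ^ 2 ≡ (v * u * (v * u) - c) * u ^ 2
  l₁ = solve 3 (λ c v u → v :* v :* u :^ 4 :+ :- c :* u :^ 2 :=
      (v :* u :* (v :* u) :- c) :* u :^ 2) refl
  l₂ : ∀ c v u → v * v * u ^ 6 + - c * u ^ 4 + 0ℚ * u ^ 2 ≡ (v * u * (v * u) - c) * u ^ 4
  l₂ = solve 3 (λ c v u → v :* v :* u :^ 6 :+ :- c :* u :^ 4 :+ con 0ℚ :* u :^ 2 :=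
      (v :* u :* (v :* u) :- c) :* u :^ 4) refl

quad1*I : ∀ j → quad 1ℚ j *ⱼ I j ≡ 1ⱼ
quad1*I j = trans (quad*I 1ℚ j) (jet-≡ refl (*-zeroˡ (inv j ^ 2)) (*-zeroˡ (inv j ^ 4)))

-- In closed form, 1 / C(2n,n) times ∏ (j² - 4y) over 1 ≤ j ≤ n, divided by ∏ (j² - y) over k < j ≤
-- k + n + 1. The scalar `ν (suc n) * d n` is C(2n,n) / C(2n+2,n+1).
F : ℕ → ℕ → Jet
F zero    k = I k
F (suc n) k = F n k *ⱼ (ι (ν (suc n)) *ⱼ ι (d n) *ⱼ quad 4ℚ n) *ⱼ I (suc (k ℕ.+ n))

-- The WZ mate of `F`. At k = 0 it is the term of index n + 1 of the series, since 3 (n + 1) d(n) /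
-- C(2n,n) = 3 / C(2n+2,n+1).
G : ℕ → ℕ → Jet
G n k = F n k *ⱼ ((3ⱼ *ⱼ ι (ν (suc n)) +ⱼ 2ⱼ *ⱼ ι (ν k)) *ⱼ ι (d n))

-- Raising k shifts the window of denominators: (k + 1)² - y leaves and (k + n + 2)² - y enters.
F-suc : ∀ n k → F n (suc k) ≡ F n k *ⱼ quad 1ℚ k *ⱼ I (suc (k ℕ.+ n))
F-suc zero k = begin
  I (suc k)                             ≡⟨ *ⱼ-identityˡ (I (suc k)) ⟨
  1ⱼ *ⱼ I (suc k)                       ≡⟨ cong (_*ⱼ I (suc k)) (quad1*I k) ⟨
  quad 1ℚ k *ⱼ I k *ⱼ I (suc k)
    ≡⟨ cong₂ _*ⱼ_ (*ⱼ-comm (quad 1ℚ k) (I k)) (cong (λ j → I (suc j)) (sym (ℕ.+-identityʳ k))) ⟩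
  I k *ⱼ quad 1ℚ k *ⱼ I (suc (k ℕ.+ 0))     ∎
  where open ≡-Reasoning
F-suc (suc n) k = begin
  F n (suc k) *ⱼ c *ⱼ I (suc (suc (k ℕ.+ n)))
    ≡⟨ cong₂ (λ f j → f *ⱼ c *ⱼ I (suc j)) (F-suc n k) (sym (ℕ.+-suc k n)) ⟩
  F n k *ⱼ quad 1ℚ k *ⱼ i *ⱼ c *ⱼ i′
    ≡⟨ solve 5 (λ f e i c i′ → f :* e :* i :* c :* i′ :=
        f :* c :* i :* e :* i′) refl (F n k) (quad 1ℚ k) i c i′ ⟩
  F n k *ⱼ c *ⱼ i *ⱼ quad 1ℚ k *ⱼ i′                 ∎
  where
  open ≡-Reasoning
  open JetSolver
  c i i′ : Jet
  c = ι (ν (suc n)) *ⱼ ι (d n) *ⱼ quad 4ℚ n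
  i = I (suc (k ℕ.+ n))
  i′ = I (suc (k ℕ.+ suc n))

-- Writing f as 2 (2n + 1) ((k + n + 2)² - y) times D i f turns both sides into polynomial
-- multiples of D i f.
wz-polynomial : ∀ n k Y D i f →
  2ⱼ *ⱼ (1ⱼ +ⱼ 2ⱼ *ⱼ n) *ⱼ D ≡ 1ⱼ →
  ((1ⱼ +ⱼ (1ⱼ +ⱼ (k +ⱼ n))) *ⱼ (1ⱼ +ⱼ (1ⱼ +ⱼ (k +ⱼ n))) -ⱼ 1ⱼ *ⱼ Y) *ⱼ i ≡ 1ⱼ →
  f *ⱼ ((1ⱼ +ⱼ n) *ⱼ D *ⱼ ((1ⱼ +ⱼ n) *ⱼ (1ⱼ +ⱼ n) -ⱼ 4ⱼ *ⱼ Y)) *ⱼ i -ⱼ f ≡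
  f *ⱼ ((1ⱼ +ⱼ k) *ⱼ (1ⱼ +ⱼ k) -ⱼ 1ⱼ *ⱼ Y) *ⱼ i *ⱼ ((3ⱼ *ⱼ (1ⱼ +ⱼ n) +ⱼ 2ⱼ *ⱼ (1ⱼ +ⱼ k)) *ⱼ D)
    -ⱼ f *ⱼ ((3ⱼ *ⱼ (1ⱼ +ⱼ n) +ⱼ 2ⱼ *ⱼ k) *ⱼ D)
wz-polynomial n k Y D i f c≡1 e≡1 = begin
  p -ⱼ f                                        ≡⟨ cong (p -ⱼ_) (unit f c e c≡1 e≡1) ⟩
  p -ⱼ c *ⱼ e *ⱼ f                              ≡⟨ cleared n k Y D i f ⟩
  q -ⱼ 1ⱼ *ⱼ e *ⱼ r                             ≡⟨ cong (q -ⱼ_) (unit r 1ⱼ e refl e≡1) ⟨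
  q -ⱼ r                                        ∎
  where
  open ≡-Reasoning
  open JetSolver
  p q r c e : Jet
  p = f *ⱼ ((1ⱼ +ⱼ n) *ⱼ D *ⱼ ((1ⱼ +ⱼ n) *ⱼ (1ⱼ +ⱼ n) -ⱼ 4ⱼ *ⱼ Y)) *ⱼ i
  q = f *ⱼ ((1ⱼ +ⱼ k) *ⱼ (1ⱼ +ⱼ k) -ⱼ 1ⱼ *ⱼ Y) *ⱼ i *ⱼ ((3ⱼ *ⱼ (1ⱼ +ⱼ n) +ⱼ 2ⱼ *ⱼ (1ⱼ +ⱼ k)) *ⱼ D)
  r = f *ⱼ ((3ⱼ *ⱼ (1ⱼ +ⱼ n) +ⱼ 2ⱼ *ⱼ k) *ⱼ D)
  c = 2ⱼ *ⱼ (1ⱼ +ⱼ 2ⱼ *ⱼ n) *ⱼ D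
  e = ((1ⱼ +ⱼ (1ⱼ +ⱼ (k +ⱼ n))) *ⱼ (1ⱼ +ⱼ (1ⱼ +ⱼ (k +ⱼ n))) -ⱼ 1ⱼ *ⱼ Y) *ⱼ i
  unit : ∀ x c e → c ≡ 1ⱼ → e ≡ 1ⱼ → x ≡ c *ⱼ e *ⱼ x
  unit x c e refl refl = sym (*ⱼ-identityˡ x)
  cleared : ∀ n k Y D i f → _
  cleared = solve 6 (λ n k Y D i f →
    let m  = con 1ⱼ :+ n
        k′ = con 1ⱼ :+ k
        g  = con 1ⱼ :+ (con 1ⱼ :+ (k :+ n))
        e  = (g :* g :- con 1ⱼ :* Y) :* i
    in f :* (m :* D :* (m :* m :- con 4ⱼ :* Y)) :* i :- con 2ⱼ :* (con 1ⱼ :+ con 2ⱼ :* n) :* D :* e :* f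
    := f :* (k′ :* k′ :- con 1ⱼ :* Y) :* i :* ((con 3ⱼ :* m :+ con 2ⱼ :* k′) :* D)
         :- con 1ⱼ :* e :* (f :* ((con 3ⱼ :* m :+ con 2ⱼ :* k) :* D))) refl

wz : ∀ n k → F (suc n) k -ⱼ F n k ≡ G n (suc k) -ⱼ G n k
wz n k = trans
  -- Since `1ⱼ +ⱼ ι (ν n)` computes to `ι (ν (suc n))`, the successors match by definition; in the
  -- inverse relation for `I` only `ν (k ℕ.+ n)` has to be split.
  (wz-polynomial (ι (ν n)) (ι (ν k)) y (ι (d n)) (I (suc (k ℕ.+ n))) (F n k) (d-inverse n)
    (subst (λ z → (ι (1ℚ + (1ℚ + z)) *ⱼ ι (1ℚ + (1ℚ + z)) -ⱼ 1ⱼ *ⱼ y) *ⱼ I (suc (k ℕ.+ n)) ≡ 1ⱼ)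
      (ν-+ k n) (quad1*I (suc (k ℕ.+ n)))))
  (cong (λ f → f *ⱼ ((3ⱼ *ⱼ ι (ν (suc n)) +ⱼ 2ⱼ *ⱼ ι (ν (suc k))) *ⱼ ι (d n)) -ⱼ G n k)
    (sym (F-suc n k)))

∑ : (ℕ → Jet) → ℕ → Jet
∑ f zero    = 0ⱼ
∑ f (suc n) = ∑ f n +ⱼ f n

-- `wz` telescoped over k < K, with the negative terms moved across.
∑F-suc : ∀ n K → ∑ (F (suc n)) K +ⱼ G n 0 ≡ ∑ (F n) K +ⱼ G n K
∑F-suc n zero    = refl
∑F-suc n (suc K) = begin
  ∑ (F (suc n)) K +ⱼ F (suc n) K +ⱼ G n 0
    ≡⟨ solve 4 (λ a b c d → a :+ b :+ c :=
        (a :+ c) :+ (b :- d) :+ d) refl (∑ (F (suc n)) K) (F (suc n) K) (G n 0) (F n K) ⟩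
  (∑ (F (suc n)) K +ⱼ G n 0) +ⱼ (F (suc n) K -ⱼ F n K) +ⱼ F n K
    ≡⟨ cong₂ (λ a b → a +ⱼ b +ⱼ F n K) (∑F-suc n K) (wz n K) ⟩
  (∑ (F n) K +ⱼ G n K) +ⱼ (G n (suc K) -ⱼ G n K) +ⱼ F n K
    ≡⟨ solve 4 (λ a b c d → (a :+ b) :+ (c :- b) :+ d :=
        a :+ d :+ c) refl (∑ (F n) K) (G n K) (G n (suc K)) (F n K) ⟩
  ∑ (F n) K +ⱼ F n K +ⱼ G n (suc K) ∎
  where
  open ≡-Reasoning
  open JetSolver

-- Telescoping also in the other direction leaves the four edges of the rectangle. The edges k = 0
-- and n = 0 are the series and the zeta sums; the two opposite ones are the error terms.
∑-closed : ∀ n K → ∑ (F n) K +ⱼ ∑ (λ m → G m 0) n ≡ ∑ I K +ⱼ ∑ (λ m → G m K) n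
∑-closed zero    K = refl
∑-closed (suc n) K = begin
  ∑ (F (suc n)) K +ⱼ (∑ (λ m → G m 0) n +ⱼ G n 0)
    ≡⟨ solve 3 (λ a b c → a :+ (b :+ c) :=
        a :+ c :+ b) refl (∑ (F (suc n)) K) (∑ (λ m → G m 0) n) (G n 0) ⟩
  ∑ (F (suc n)) K +ⱼ G n 0 +ⱼ ∑ (λ m → G m 0) n
    ≡⟨ cong (_+ⱼ ∑ (λ m → G m 0) n) (∑F-suc n K) ⟩
  ∑ (F n) K +ⱼ G n K +ⱼ ∑ (λ m → G m 0) n
    ≡⟨ solve 3 (λ a b c → a :+ b :+ c := a :+ c :+ b) refl (∑ (F n) K) (G n K) (∑ (λ m → G m 0) n) ⟩
  ∑ (F n) K +ⱼ ∑ (λ m → G m 0) n +ⱼ G n K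
    ≡⟨ cong (_+ⱼ G n K) (∑-closed n K) ⟩
  ∑ I K +ⱼ ∑ (λ m → G m K) n +ⱼ G n K
    ≡⟨ solve 3 (λ a b c → a :+ b :+ c := a :+ (b :+ c)) refl (∑ I K) (∑ (λ m → G m K) n) (G n K) ⟩
  ∑ I K +ⱼ (∑ (λ m → G m K) n +ⱼ G n K) ∎
  where
  open ≡-Reasoning
  open JetSolver

∑I≡H : ∀ K → ∑ I K ≡ ⟨ H 2 K , H 4 K , H 6 K ⟩
∑I≡H zero    = refl
∑I≡H (suc K) = trans (cong (_+ⱼ I K) (∑I≡H K)) (sym (jet-≡
  (cong (λ z → H 2 K + z) (recip-^ K 2))
  (cong (λ z → H 4 K + z) (recip-^ K 4))
  (cong (λ z → H 6 K + z) (recip-^ K 6))))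

-- Toeplitz blocks as jets

toeplitz : Jet → Jet → Matrix ℚ 4
toeplitz ⟨ p₀ , p₁ , p₂ ⟩ ⟨ s₀ , s₁ , s₂ ⟩ =
    (p₀ ∷ p₁ ∷ p₂ ∷ s₂ ∷ [])
  ∷ (0ℚ ∷ p₀ ∷ p₁ ∷ s₁ ∷ [])
  ∷ (0ℚ ∷ 0ℚ ∷ p₀ ∷ s₀ ∷ [])
  ∷ (0ℚ ∷ 0ℚ ∷ 0ℚ ∷ 1ℚ ∷ [])
  ∷ []

-- Composition of the affine maps x ↦ p x + s and x ↦ t x + v. The last column lists the
-- coefficients from y² down to 1, because the top row of a Toeplitz block computes the y²
-- coefficient of a product.
toeplitz-⊗ : ∀ p s t v i j → (toeplitz p s ⊗ toeplitz t v) i j ≡ toeplitz (p *ⱼ t) (s +ⱼ p *ⱼ v) i j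
toeplitz-⊗ ⟨ p₀ , p₁ , p₂ ⟩ ⟨ s₀ , s₁ , s₂ ⟩ ⟨ t₀ , t₁ , t₂ ⟩ ⟨ v₀ , v₁ , v₂ ⟩ = λ where
    0F 0F → solve 5 (λ p₀ p₁ p₂ s₂ t₀ → p₀ :* t₀ :+ (p₁ :* o :+ (p₂ :* o :+ (s₂ :* o :+ o))) :=
        p₀ :* t₀) refl p₀ p₁ p₂ s₂ t₀
    0F 1F → solve 6 (λ p₀ p₁ p₂ s₂ t₀ t₁ → p₀ :* t₁ :+ (p₁ :* t₀ :+ (p₂ :* o :+ (s₂ :* o :+ o))) :=
        p₀ :* t₁ :+ p₁ :* t₀) refl p₀ p₁ p₂ s₂ t₀ t₁
    0F 2F → solve 7 (λ p₀ p₁ p₂ s₂ t₀ t₁ t₂ → p₀ :* t₂ :+ (p₁ :* t₁ :+ (p₂ :* t₀ :+ (s₂ :* o :+ o))) :=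
        p₀ :* t₂ :+ p₁ :* t₁ :+ p₂ :* t₀) refl p₀ p₁ p₂ s₂ t₀ t₁ t₂
    0F 3F → solve 7 (λ p₀ p₁ p₂ s₂ v₀ v₁ v₂ → p₀ :* v₂ :+ (p₁ :* v₁ :+ (p₂ :* v₀ :+ (s₂ :* l :+ o))) :=
        s₂ :+ (p₀ :* v₂ :+ p₁ :* v₁ :+ p₂ :* v₀)) refl p₀ p₁ p₂ s₂ v₀ v₁ v₂
    1F 0F → solve 4 (λ p₀ p₁ s₁ t₀ → o :* t₀ :+ (p₀ :* o :+ (p₁ :* o :+ (s₁ :* o :+ o))) :=
        o) refl p₀ p₁ s₁ t₀
    1F 1F → solve 5 (λ p₀ p₁ s₁ t₀ t₁ → o :* t₁ :+ (p₀ :* t₀ :+ (p₁ :* o :+ (s₁ :* o :+ o))) :=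
        p₀ :* t₀) refl p₀ p₁ s₁ t₀ t₁
    1F 2F → solve 6 (λ p₀ p₁ s₁ t₀ t₁ t₂ → o :* t₂ :+ (p₀ :* t₁ :+ (p₁ :* t₀ :+ (s₁ :* o :+ o))) :=
        p₀ :* t₁ :+ p₁ :* t₀) refl p₀ p₁ s₁ t₀ t₁ t₂
    1F 3F → solve 6 (λ p₀ p₁ s₁ v₀ v₁ v₂ → o :* v₂ :+ (p₀ :* v₁ :+ (p₁ :* v₀ :+ (s₁ :* l :+ o))) :=
        s₁ :+ (p₀ :* v₁ :+ p₁ :* v₀)) refl p₀ p₁ s₁ v₀ v₁ v₂
    2F 0F → solve 3 (λ p₀ s₀ t₀ → o :* t₀ :+ (o :* o :+ (p₀ :* o :+ (s₀ :* o :+ o))) :=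
        o) refl p₀ s₀ t₀
    2F 1F → solve 4 (λ p₀ s₀ t₀ t₁ → o :* t₁ :+ (o :* t₀ :+ (p₀ :* o :+ (s₀ :* o :+ o))) :=
        o) refl p₀ s₀ t₀ t₁
    2F 2F → solve 5 (λ p₀ s₀ t₀ t₁ t₂ → o :* t₂ :+ (o :* t₁ :+ (p₀ :* t₀ :+ (s₀ :* o :+ o))) :=
        p₀ :* t₀) refl p₀ s₀ t₀ t₁ t₂
    2F 3F → solve 5 (λ p₀ s₀ v₀ v₁ v₂ → o :* v₂ :+ (o :* v₁ :+ (p₀ :* v₀ :+ (s₀ :* l :+ o))) :=
        s₀ :+ (p₀ :* v₀)) refl p₀ s₀ v₀ v₁ v₂
    3F 0F → solve 1 (λ t₀ → o :* t₀ :+ (o :* o :+ (o :* o :+ (l :* o :+ o))) := o) refl t₀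
    3F 1F → solve 2 (λ t₀ t₁ → o :* t₁ :+ (o :* t₀ :+ (o :* o :+ (l :* o :+ o))) := o) refl t₀ t₁
    3F 2F → solve 3 (λ t₀ t₁ t₂ → o :* t₂ :+ (o :* t₁ :+ (o :* t₀ :+ (l :* o :+ o))) :=
        o) refl t₀ t₁ t₂
    3F 3F → solve 3 (λ v₀ v₁ v₂ → o :* v₂ :+ (o :* v₁ :+ (o :* v₀ :+ (l :* l :+ o))) :=
        l) refl v₀ v₁ v₂
  where
  open +-*-Solver
  o l : ∀ {n} → Polynomial n
  o = con 0ℚ
  l = con 1ℚ

-- Read off from the entries, so that `factor-≡` holds by computation; the closed forms are `T-≡`
-- and `V-≡`.
T V : ℕ → Jet
T m = ⟨ factor (suc m) 0F 0F , factor (suc m) 0F 1F , 0ℚ ⟩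
V m = ⟨ factor (suc m) 2F 3F , factor (suc m) 1F 3F , factor (suc m) 0F 3F ⟩

factor-≡ : ∀ m i j → factor (suc m) i j ≡ toeplitz (T m) (V m) i j
factor-≡ m = λ where
  0F j → refl
  1F j → refl
  2F j → refl
  3F j → refl

P : ℕ → Jet
P zero    = 1ⱼ
P (suc m) = P m *ⱼ T m

identity-≡ : ∀ i j → identity i j ≡ toeplitz 1ⱼ 0ⱼ i j
identity-≡ = λ where
  0F 0F → refl
  0F 1F → refl
  0F 2F → refl
  0F 3F → refl
  1F 0F → refl
  1F 1F → refl
  1F 2F → refl
  1F 3F → refl
  2F 0F → refl
  2F 1F → refl
  2F 2F → refl
  2F 3F → refl
  3F 0F → refl
  3F 1F → refl
  3F 2F → refl
  3F 3F → refl

partialProduct-≡ : ∀ m i j →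
  partialProduct factor m i j ≡ toeplitz (P m) (∑ (λ n → P n *ⱼ V n) m) i j
partialProduct-≡ zero    i j = identity-≡ i j
partialProduct-≡ (suc m) i j = trans
  (sum-cong-≗ (λ l → cong₂ _*_ (partialProduct-≡ m i l) (factor-≡ m l j)))
  (toeplitz-⊗ (P m) (∑ (λ n → P n *ⱼ V n) m) (T m) (V m) i j)

-- Matching the last column with the series

-- The product of the 1 - 3 y² / j⁴ for j ≤ m; it accounts for the H 4 term of the factors, as
-- (1 - 3 y / j²) (1 - 3 y² / j⁴) = (j² - 4y) / (j² - y) modulo y³.
E : ℕ → Jet
E m = ⟨ 1ℚ , 0ℚ , - (3ℚ * H 4 m) ⟩

recip-cong : ∀ {m n} .{{_ : NonZero m}} .{{_ : NonZero n}} → m ≡ n → + 1 / m ≡ + 1 / n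
recip-cong refl = refl

module _ (m : ℕ) where
  private
    n : ℕ
    n = suc m
    u v w : ℚ
    u = inv m
    v = ν n
    w = inv (2 ℕ.* n)

    w-≡ : + 1 / (2 ℕ.* n ℕ.+ 1) ≡ w
    w-≡ = recip-cong (ℕ.+-comm (2 ℕ.* n) 1)

  -- The superdiagonal entry of the factor is -3 / n² times its diagonal entry.
  T-≡ : T m ≡ ι v *ⱼ ι (d n) *ⱼ ⟨ 1ℚ , - (3ℚ * u ^ 2) , 0ℚ ⟩
  T-≡ = trans (jet-≡ a-≡ b-≡ refl) (sym (trans
      (cong (_*ⱼ ⟨ 1ℚ , - (3ℚ * u ^ 2) , 0ℚ ⟩) (ι-* v (d n)))
      (jet-≡ (*-identityʳ (v * d n))
             (trans (l₁ v u w) (cong (λ z → - (3ℚ * (½ * u * w) * z)) (ν*inv m)))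
             (l₂ v u w))))
    where
    open ≡-Reasoning
    open +-*-Solver
    a-≡ : factor n 0F 0F ≡ v * d n
    a-≡ = begin
      + n / (2 ℕ.* (2 ℕ.* n ℕ.+ 1))          ≡⟨ /≡ν*recip n (2 ℕ.* (2 ℕ.* n ℕ.+ 1)) ⟩
      v * (+ 1 / (2 ℕ.* (2 ℕ.* n ℕ.+ 1)))    ≡⟨ cong (v *_) (recip-* 2 (2 ℕ.* n ℕ.+ 1)) ⟩
      v * (½ * (+ 1 / (2 ℕ.* n ℕ.+ 1)))      ≡⟨ cong (λ z → v * (½ * z)) w-≡ ⟩
      v * d n                                ∎
    -- The final 1ℚ is the place of v u, which `l₁` produces and `ν*inv` evaluates.
    b-≡ : factor n 0F 1F ≡ - (3ℚ * (½ * u * w) * 1ℚ)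
    b-≡ = cong (λ z → - z) (begin
      + 3 / (2 ℕ.* n ℕ.* (2 ℕ.* n ℕ.+ 1))
        ≡⟨ /≡ν*recip 3 (2 ℕ.* n ℕ.* (2 ℕ.* n ℕ.+ 1)) ⟩
      3ℚ * (+ 1 / (2 ℕ.* n ℕ.* (2 ℕ.* n ℕ.+ 1)))
        ≡⟨ cong (3ℚ *_) (recip-* (2 ℕ.* n) (2 ℕ.* n ℕ.+ 1)) ⟩
      3ℚ * ((+ 1 / (2 ℕ.* n)) * (+ 1 / (2 ℕ.* n ℕ.+ 1)))
        ≡⟨ cong₂ (λ x z → 3ℚ * (x * z)) (recip-* 2 n) w-≡ ⟩
      3ℚ * (½ * u * w)                                  ≡⟨ *-identityʳ (3ℚ * (½ * u * w)) ⟨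
      3ℚ * (½ * u * w) * 1ℚ                             ∎)
    l₁ : ∀ v u w → v * (½ * w) * - (3ℚ * u ^ 2) + 0ℚ * 1ℚ ≡ - (3ℚ * (½ * u * w) * (v * u))
    l₁ = solve 3 (λ v u w → v :* (con ½ :* w) :* :- (con 3ℚ :* u :^ 2) :+ con 0ℚ :* con 1ℚ :=
                          :- (con 3ℚ :* (con ½ :* u :* w) :* (v :* u))) refl
    l₂ : ∀ v u w → v * (½ * w) * 0ℚ + 0ℚ * - (3ℚ * u ^ 2) + 0ℚ * 1ℚ ≡ 0ℚ
    l₂ = solve 3 (λ v u w →
      v :* (con ½ :* w) :* con 0ℚ :+ con 0ℚ :* :- (con 3ℚ :* u :^ 2) :+ con 0ℚ :* con 1ℚ :=
        con 0ℚ) refl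

  -- As E(n) = E(m) (1 - 3 y² / n⁴) modulo y³, the correction `E` turns each factor 1 - 3 y / n² of
  -- `P` into the ratio (n² - 4y) / (n² - y).
  T*E : T m *ⱼ E n ≡ ι v *ⱼ ι (d n) *ⱼ (E m *ⱼ (quad 4ℚ m *ⱼ I m))
  T*E = begin
    T m *ⱼ E n                                                          ≡⟨ cong (_*ⱼ E n) T-≡ ⟩
    ι v *ⱼ ι (d n) *ⱼ ⟨ 1ℚ , - (3ℚ * u ^ 2) , 0ℚ ⟩ *ⱼ E n
      ≡⟨ *ⱼ-assoc (ι v *ⱼ ι (d n)) ⟨ 1ℚ , - (3ℚ * u ^ 2) , 0ℚ ⟩ (E n) ⟩
    ι v *ⱼ ι (d n) *ⱼ (⟨ 1ℚ , - (3ℚ * u ^ 2) , 0ℚ ⟩ *ⱼ E n)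
      ≡⟨ cong (ι v *ⱼ ι (d n) *ⱼ_) (trans
       (cong (λ z → ⟨ 1ℚ , - (3ℚ * u ^ 2) , 0ℚ ⟩ *ⱼ ⟨ 1ℚ , 0ℚ , - (3ℚ * (H 4 m + z)) ⟩) (recip-^ m 4))
       (jet-≡ refl (l₁ u) (l₂ u (H 4 m)))) ⟩
    ι v *ⱼ ι (d n) *ⱼ (E m *ⱼ ⟨ 1ℚ , (1ℚ - 4ℚ) * u ^ 2 , (1ℚ - 4ℚ) * u ^ 4 ⟩)
      ≡⟨ cong (λ z → ι v *ⱼ ι (d n) *ⱼ (E m *ⱼ z)) (quad*I 4ℚ m) ⟨
    ι v *ⱼ ι (d n) *ⱼ (E m *ⱼ (quad 4ℚ m *ⱼ I m)) ∎
    where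
    open ≡-Reasoning
    open +-*-Solver
    l₁ : ∀ u → 1ℚ * 0ℚ + - (3ℚ * u ^ 2) * 1ℚ ≡ 1ℚ * ((1ℚ - 4ℚ) * u ^ 2) + 0ℚ * 1ℚ
    l₁ = solve 1 (λ u → con 1ℚ :* con 0ℚ :+ :- (con 3ℚ :* u :^ 2) :* con 1ℚ :=
        con 1ℚ :* ((con 1ℚ :- con 4ℚ) :* u :^ 2) :+ con 0ℚ :* con 1ℚ) refl
    l₂ : ∀ u h →
      1ℚ * - (3ℚ * (h + u ^ 4)) + - (3ℚ * u ^ 2) * 0ℚ + 0ℚ * 1ℚ
      ≡ 1ℚ * ((1ℚ - 4ℚ) * u ^ 4) + 0ℚ * ((1ℚ - 4ℚ) * u ^ 2) + - (3ℚ * h) * 1ℚ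
    l₂ = solve 2 (λ u h →
      con 1ℚ :* :- (con 3ℚ :* (h :+ u :^ 4)) :+ :- (con 3ℚ :* u :^ 2) :* con 0ℚ :+ con 0ℚ :* con 1ℚ :=
      con 1ℚ :* ((con 1ℚ :- con 4ℚ) :* u :^ 4) :+ con 0ℚ :* ((con 1ℚ :- con 4ℚ) :* u :^ 2) :+ :- (con 3ℚ :* h) :* con 1ℚ) refl

  -- The `H 4` term of the matrix arises here: it is the contribution of -3 H y² in `E m` to the y²
  -- coefficient of (3n / 2) E(m) / (n² - y).
  V-≡ : V m ≡ ι (3ℚ * ½) *ⱼ ι v *ⱼ (E m *ⱼ I m)
  V-≡ = begin
    V m ≡⟨ jet-≡ v₀-≡ (v-≡ 3) (cong₂ (λ x z → x - z * H 4 m) (v-≡ 5) v₂-≡) ⟩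
    jet 1ℚ ≡⟨ cong jet (ν*inv m) ⟨
    jet (v * u) ≡⟨ jet-≡ (l₀ v u (H 4 m)) (l₁ v u (H 4 m)) (l₂ v u (H 4 m)) ⟨
    ι (3ℚ * ½ * v) *ⱼ (E m *ⱼ I m) ≡⟨ cong (_*ⱼ (E m *ⱼ I m)) (ι-* (3ℚ * ½) v) ⟨
    ι (3ℚ * ½) *ⱼ ι v *ⱼ (E m *ⱼ I m) ∎
    where
    open ≡-Reasoning
    open +-*-Solver
    9ℚ : ℚ
    9ℚ = + 9 / 1
    jet : ℚ → Jet
    jet t = ⟨ t * (3ℚ * (½ * u)) , t * (3ℚ * (½ * u ^ 3))
              , t * (3ℚ * (½ * u ^ 5)) - t * (9ℚ * (½ * u)) * H 4 m ⟩
    v₀-≡ : + 3 / (2 ℕ.* n) ≡ 1ℚ * (3ℚ * (½ * u))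
    v₀-≡ = trans (/≡ν*recip 3 (2 ℕ.* n)) (trans (cong (3ℚ *_) (recip-* 2 n)) (sym (*-identityˡ _)))
    v₂-≡ : + 9 / (2 ℕ.* n) ≡ 1ℚ * (9ℚ * (½ * u))
    v₂-≡ = trans (/≡ν*recip 9 (2 ℕ.* n)) (trans (cong (9ℚ *_) (recip-* 2 n)) (sym (*-identityˡ _)))
    v-≡ : ∀ s .{{_ : NonZero (2 ℕ.* n ℕ.^ s)}} → + 3 / (2 ℕ.* n ℕ.^ s) ≡ 1ℚ * (3ℚ * (½ * u ^ s))
    v-≡ s = trans (/≡ν*recip 3 (2 ℕ.* n ℕ.^ s)) (trans (cong (3ℚ *_) (trans
      (recip-* 2 (n ℕ.^ s) {{_}} {{ℕ.m^n≢0 n s}})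
      (cong (½ *_) (recip-^ m s {{ℕ.m^n≢0 n s}})))) (sym (*-identityˡ _)))
    l₀ : ∀ v u h → 3ℚ * ½ * v * (1ℚ * u ^ 2) ≡ v * u * (3ℚ * (½ * u))
    l₀ = solve 3 (λ v u h → con 3ℚ :* con ½ :* v :* (con 1ℚ :* u :^ 2) :=
        v :* u :* (con 3ℚ :* (con ½ :* u))) refl
    l₁ : ∀ v u h →
      3ℚ * ½ * v * (1ℚ * u ^ 4 + 0ℚ * u ^ 2) + 0ℚ * (1ℚ * u ^ 2) ≡ v * u * (3ℚ * (½ * u ^ 3))
    l₁ = solve 3 (λ v u h →
      con 3ℚ :* con ½ :* v :* (con 1ℚ :* u :^ 4 :+ con 0ℚ :* u :^ 2) :+ con 0ℚ :* (con 1ℚ :* u :^ 2) :=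
        v :* u :* (con 3ℚ :* (con ½ :* u :^ 3))) refl
    l₂ : ∀ v u h →
      3ℚ * ½ * v * (1ℚ * u ^ 6 + 0ℚ * u ^ 4 + - (3ℚ * h) * u ^ 2) + 0ℚ * (1ℚ * u ^ 4 + 0ℚ * u ^ 2) + 0ℚ * (1ℚ * u ^ 2)
       ≡ v * u * (3ℚ * (½ * u ^ 5)) - v * u * (9ℚ * (½ * u)) * h
    l₂ = solve 3 (λ v u h →
      con 3ℚ :* con ½ :* v :* (con 1ℚ :* u :^ 6 :+ con 0ℚ :* u :^ 4 :+ :- (con 3ℚ :* h) :* u :^ 2) :+ con 0ℚ :* (con 1ℚ :* u :^ 4 :+ con 0ℚ :* u :^ 2) :+ con 0ℚ :* (con 1ℚ :* u :^ 2)
       := v :* u :* (con 3ℚ :* (con ½ :* u :^ 5)) :- v :* u :* (con 9ℚ :* (con ½ :* u)) :* h) refl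

-- `P m` contains d(1), ..., d(m) whereas `F m 0` contains d(0), ..., d(m - 1); the shift costs d(m)
-- / d(0) = 2 d(m).
P*E*I : ∀ m → P m *ⱼ (E m *ⱼ I m) ≡ 2ⱼ *ⱼ ι (d m) *ⱼ F m 0
P*E*I zero    = refl
P*E*I (suc m) = begin
  P m *ⱼ T m *ⱼ (E (suc m) *ⱼ I (suc m))
    ≡⟨ solve 4 (λ p t e i → p :* t :* (e :* i) :=
        p :* (t :* e) :* i) refl (P m) (T m) (E (suc m)) (I (suc m)) ⟩
  P m *ⱼ (T m *ⱼ E (suc m)) *ⱼ I (suc m)
    ≡⟨ cong (λ z → P m *ⱼ z *ⱼ I (suc m)) (T*E m) ⟩
  P m *ⱼ (v *ⱼ D′ *ⱼ (E m *ⱼ (q *ⱼ I m))) *ⱼ I (suc m)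
    ≡⟨ solve 7 (λ p v D′ e q i i′ → p :* (v :* D′ :* (e :* (q :* i))) :* i′ :=
        p :* (e :* i) :* (v :* D′ :* q :* i′)) refl (P m) v D′ (E m) q (I m) (I (suc m)) ⟩
  P m *ⱼ (E m *ⱼ I m) *ⱼ (v *ⱼ D′ *ⱼ q *ⱼ I (suc m))
    ≡⟨ cong (_*ⱼ (v *ⱼ D′ *ⱼ q *ⱼ I (suc m))) (P*E*I m) ⟩
  2ⱼ *ⱼ ι (d m) *ⱼ F m 0 *ⱼ (v *ⱼ D′ *ⱼ q *ⱼ I (suc m))
    ≡⟨ solve 6 (λ D f v D′ q i′ → con 2ⱼ :* D :* f :* (v :* D′ :* q :* i′) :=
        con 2ⱼ :* D′ :* (f :* (v :* D :* q) :* i′)) refl (ι (d m)) (F m 0) v D′ q (I (suc m)) ⟩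
  2ⱼ *ⱼ D′ *ⱼ F (suc m) 0 ∎
  where
  open ≡-Reasoning
  open JetSolver
  v D′ q : Jet
  v = ι (ν (suc m))
  D′ = ι (d (suc m))
  q = quad 4ℚ m

-- Identifies the increments of the last column with the terms of the series.
P*V≡G : ∀ m → P m *ⱼ V m ≡ G m 0
P*V≡G m = begin
  P m *ⱼ V m                                        ≡⟨ cong (P m *ⱼ_) (V-≡ m) ⟩
  P m *ⱼ (ι (3ℚ * ½) *ⱼ v *ⱼ (E m *ⱼ I m))
    ≡⟨ solve 3 (λ p v e → p :* (con (ι (3ℚ * ½)) :* v :* e) :=
        p :* e :* (con (ι (3ℚ * ½)) :* v)) refl (P m) v (E m *ⱼ I m) ⟩
  P m *ⱼ (E m *ⱼ I m) *ⱼ (ι (3ℚ * ½) *ⱼ v)          ≡⟨ cong (_*ⱼ (ι (3ℚ * ½) *ⱼ v)) (P*E*I m) ⟩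
  2ⱼ *ⱼ D *ⱼ F m 0 *ⱼ (ι (3ℚ * ½) *ⱼ v)
    -- The summand `con 2ⱼ :* con 0ⱼ` is the term 2k of the multiplier in `G`, taken at k = 0.
    ≡⟨ solve 3 (λ D f v → con 2ⱼ :* D :* f :* (con (ι (3ℚ * ½)) :* v) :=
        f :* ((con 3ⱼ :* v :+ con 2ⱼ :* con 0ⱼ) :* D)) refl D (F m 0) v ⟩
  G m 0                                             ∎
  where
  open ≡-Reasoning
  open JetSolver
  v D : Jet
  v = ι (ν (suc m))
  D = ι (d m)

-- Nonnegativity and the weighted norm

0≤+ : ∀ {p q} → 0ℚ ≤ p → 0ℚ ≤ q → 0ℚ ≤ p + q
0≤+ = +-mono-≤

0≤* : ∀ {p q} → 0ℚ ≤ p → 0ℚ ≤ q → 0ℚ ≤ p * q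
0≤* {p} {q} 0≤p 0≤q = nonNegative⁻¹ (p * q)
  {{nonNeg*nonNeg⇒nonNeg p {{nonNegative 0≤p}} q {{nonNegative 0≤q}}}}

0≤1 : 0ℚ ≤ 1ℚ
0≤1 = from-yes (0ℚ ≤? 1ℚ)

0≤½ : 0ℚ ≤ ½
0≤½ = from-yes (0ℚ ≤? ½)

0≤^ : ∀ {p} n → 0ℚ ≤ p → 0ℚ ≤ p ^ n
0≤^ zero    0≤p = 0≤1
0≤^ (suc n) 0≤p = 0≤* 0≤p (0≤^ n 0≤p)

*-mono-≤ : ∀ {p q r s} → 0ℚ ≤ r → 0ℚ ≤ q → p ≤ q → r ≤ s → p * r ≤ q * s
*-mono-≤ {p} {q} {r} {s} 0≤r 0≤q p≤q r≤s = ≤-trans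
  (*-monoʳ-≤-nonNeg r {{nonNegative 0≤r}} p≤q) (*-monoˡ-≤-nonNeg q {{nonNegative 0≤q}} r≤s)

p+r≡q⇒p≤q : ∀ {p q r} → p + r ≡ q → 0ℚ ≤ r → p ≤ q
p+r≡q⇒p≤q {p} {r = r} refl 0≤r = subst (_≤ p + r) (+-identityʳ p) (+-monoʳ-≤ p 0≤r)

¼ : ℚ
¼ = + 1 / 4

0≤¼ : 0ℚ ≤ ¼
0≤¼ = from-yes (0ℚ ≤? ¼)

-- The weights are ½ⁱ; weights 1 would not give the contraction ‖F-suc‖ at n = k = 0.
‖_‖ : Jet → ℚ
‖ ⟨ a , b , c ⟩ ‖ = ∣ a ∣ + ½ * ∣ b ∣ + ¼ * ∣ c ∣

0≤‖_‖ : ∀ p → 0ℚ ≤ ‖ p ‖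
0≤‖ ⟨ a , b , c ⟩ ‖ = 0≤+ (0≤+ (0≤∣p∣ a) (0≤* 0≤½ (0≤∣p∣ b))) (0≤* 0≤¼ (0≤∣p∣ c))

module _ where
  open +-*-Solver

  ‖p+q‖≤‖p‖+‖q‖ : ∀ p q → ‖ p +ⱼ q ‖ ≤ ‖ p ‖ + ‖ q ‖
  ‖p+q‖≤‖p‖+‖q‖ ⟨ a , b , c ⟩ ⟨ a′ , b′ , c′ ⟩ = ≤-trans
    (+-mono-≤ (+-mono-≤ (∣p+q∣≤∣p∣+∣q∣ a a′)
                        (*-monoˡ-≤-nonNeg ½ (∣p+q∣≤∣p∣+∣q∣ b b′)))
              (*-monoˡ-≤-nonNeg ¼ (∣p+q∣≤∣p∣+∣q∣ c c′)))
    (≤-reflexive (solve 6 (λ a b c a′ b′ c′ →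
      a :+ a′ :+ con ½ :* (b :+ b′) :+ con ¼ :* (c :+ c′) :=
      a :+ con ½ :* b :+ con ¼ :* c :+ (a′ :+ con ½ :* b′ :+ con ¼ :* c′))
      refl (∣ a ∣) (∣ b ∣) (∣ c ∣) (∣ a′ ∣) (∣ b′ ∣) (∣ c′ ∣)))

  -- The weights ½ⁱ are multiplicative in the degree, so the slack consists of the products of
  -- degree 3 and 4 that vanish modulo y³.
  ‖p*q‖≤‖p‖*‖q‖ : ∀ p q → ‖ p *ⱼ q ‖ ≤ ‖ p ‖ * ‖ q ‖
  ‖p*q‖≤‖p‖*‖q‖ ⟨ a , b , c ⟩ ⟨ a′ , b′ , c′ ⟩ = ≤-trans
    (+-mono-≤ (+-mono-≤ (≤-reflexive (∣p*q∣≡∣p∣*∣q∣ a a′))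
                        (*-monoˡ-≤-nonNeg ½ (two a b′ b a′)))
              (*-monoˡ-≤-nonNeg ¼ (≤-trans (∣p+q∣≤∣p∣+∣q∣ (a * c′ + b * b′) (c * a′))
                (+-mono-≤ (two a c′ b b′) (≤-reflexive (∣p*q∣≡∣p∣*∣q∣ c a′))))))
    (p+r≡q⇒p≤q (solve 6 (λ a b c a′ b′ c′ →
      a :* a′ :+ con ½ :* (a :* b′ :+ b :* a′) :+ con ¼ :* (a :* c′ :+ b :* b′ :+ c :* a′)
        :+ con ¼ :* (con ½ :* (b :* c′ :+ c :* b′) :+ con ¼ :* (c :* c′)) :=
      (a :+ con ½ :* b :+ con ¼ :* c) :* (a′ :+ con ½ :* b′ :+ con ¼ :* c′))
      refl (∣ a ∣) (∣ b ∣) (∣ c ∣) (∣ a′ ∣) (∣ b′ ∣) (∣ c′ ∣))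
      (0≤* 0≤¼ (0≤+ (0≤* 0≤½ (0≤+ (0≤* (0≤∣p∣ b) (0≤∣p∣ c′)) (0≤* (0≤∣p∣ c) (0≤∣p∣ b′))))
                    (0≤* 0≤¼ (0≤* (0≤∣p∣ c) (0≤∣p∣ c′))))))
    where
    two : ∀ p q r s → ∣ p * q + r * s ∣ ≤ ∣ p ∣ * ∣ q ∣ + ∣ r ∣ * ∣ s ∣
    two p q r s = ≤-trans (∣p+q∣≤∣p∣+∣q∣ (p * q) (r * s))
      (≤-reflexive (cong₂ _+_ (∣p*q∣≡∣p∣*∣q∣ p q) (∣p*q∣≡∣p∣*∣q∣ r s)))

  ‖ι‖ : ∀ {a} → 0ℚ ≤ a → ‖ ι a ‖ ≡ a
  ‖ι‖ {a} 0≤a = trans (solve 1 (λ a → a :+ con ½ :* con 0ℚ :+ con ¼ :* con 0ℚ :=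
      a) refl (∣ a ∣)) (0≤p⇒∣p∣≡p 0≤a)

  ‖⟨⟩‖ : ∀ {a b c} → 0ℚ ≤ a → 0ℚ ≤ b → 0ℚ ≤ c → ‖ ⟨ a , b , c ⟩ ‖ ≡ a + ½ * b + ¼ * c
  ‖⟨⟩‖ 0≤a 0≤b 0≤c = cong₂ _+_
    (cong₂ (λ x z → x + ½ * z) (0≤p⇒∣p∣≡p 0≤a) (0≤p⇒∣p∣≡p 0≤b))
    (cong (¼ *_) (0≤p⇒∣p∣≡p 0≤c))

  ‖neg‖ : ∀ p → ‖ negⱼ p ‖ ≡ ‖ p ‖
  ‖neg‖ ⟨ a , b , c ⟩ = cong₂ _+_
    (cong₂ (λ x z → x + ½ * z) (∣-p∣≡∣p∣ a) (∣-p∣≡∣p∣ b))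
    (cong (¼ *_) (∣-p∣≡∣p∣ c))

  -- The constant 4 undoes the smallest weight ¼, so that it serves all three coefficients.
  coeff₀≤ : ∀ p → ∣ coeff₀ p ∣ ≤ 4ℚ * ‖ p ‖
  coeff₀≤ ⟨ a , b , c ⟩ = p+r≡q⇒p≤q (solve 3 (λ a b c → a :+ (con 3ℚ :* a :+ con 2ℚ :* b :+ c) :=
      con 4ℚ :* (a :+ con ½ :* b :+ con ¼ :* c)) refl (∣ a ∣) (∣ b ∣) (∣ c ∣))
    (0≤+ (0≤+ (0≤* (from-yes (0ℚ ≤? 3ℚ)) (0≤∣p∣ a)) (0≤* (from-yes (0ℚ ≤? 2ℚ)) (0≤∣p∣ b))) (0≤∣p∣ c))

  coeff₁≤ : ∀ p → ∣ coeff₁ p ∣ ≤ 4ℚ * ‖ p ‖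
  coeff₁≤ ⟨ a , b , c ⟩ = p+r≡q⇒p≤q (solve 3 (λ a b c → b :+ (con 4ℚ :* a :+ b :+ c) :=
      con 4ℚ :* (a :+ con ½ :* b :+ con ¼ :* c)) refl (∣ a ∣) (∣ b ∣) (∣ c ∣))
    (0≤+ (0≤+ (0≤* (from-yes (0ℚ ≤? 4ℚ)) (0≤∣p∣ a)) (0≤∣p∣ b)) (0≤∣p∣ c))

  coeff₂≤ : ∀ p → ∣ coeff₂ p ∣ ≤ 4ℚ * ‖ p ‖
  coeff₂≤ ⟨ a , b , c ⟩ = p+r≡q⇒p≤q (solve 3 (λ a b c → c :+ (con 4ℚ :* a :+ con 2ℚ :* b) :=
      con 4ℚ :* (a :+ con ½ :* b :+ con ¼ :* c)) refl (∣ a ∣) (∣ b ∣) (∣ c ∣))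
    (0≤+ (0≤* (from-yes (0ℚ ≤? 4ℚ)) (0≤∣p∣ a)) (0≤* (from-yes (0ℚ ≤? 2ℚ)) (0≤∣p∣ b)))

-- Estimates for the WZ pair and the Toeplitz blocks

0≤ν : ∀ n → 0ℚ ≤ ν n
0≤ν zero    = ≤-refl
0≤ν (suc n) = 0≤+ 0≤1 (0≤ν n)

0≤inv : ∀ n → 0ℚ ≤ inv n
0≤inv n = recip-nonNeg (suc n)

inv-anti : ∀ {m n} → m ℕ.≤ n → inv n ≤ inv m
inv-anti {m} {n} m≤n = recip-anti (suc m) (suc n) (ℕ.s≤s m≤n)

0≤d : ∀ n → 0ℚ ≤ d n
0≤d n = 0≤* 0≤½ (0≤inv (2 ℕ.* n))

⅛ : ℚ
⅛ = + 1 / 8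

-- Adding n d(n) on the left gives (2n + 1) d(n) = ½.
n*d≤½ : ∀ n → ν (suc n) * d n ≤ ½
n*d≤½ n = p+r≡q⇒p≤q
  (trans (lemma (ν n) (d n)) (cong (½ *_) (cong coeff₀ (d-inverse n))))
  (0≤* (0≤ν n) (0≤d n))
  where
  open +-*-Solver
  lemma : ∀ n D → (1ℚ + n) * D + n * D ≡ ½ * (2ℚ * (1ℚ + 2ℚ * n) * D)
  lemma = solve 2 (λ n D → (con 1ℚ :+ n) :* D :+ n :* D :=
      con ½ :* (con 2ℚ :* (con 1ℚ :+ con 2ℚ :* n) :* D)) refl

‖quad4‖ : ∀ n → ‖ quad 4ℚ n ‖ ≡ ν (suc n) * ν (suc n) + 2ℚ
‖quad4‖ n = trans (cong ‖_‖ (quad-≡ 4ℚ n)) (trans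
  (cong (λ z → z + ½ * 4ℚ + ¼ * 0ℚ) (0≤p⇒∣p∣≡p (0≤* (0≤ν (suc n)) (0≤ν (suc n)))))
  (solve 1 (λ v → v :+ con (½ * 4ℚ) :+ con (¼ * 0ℚ) := v :+ con 2ℚ) refl (ν (suc n) * ν (suc n))))
  where open +-*-Solver

‖I‖ : ∀ j → ‖ I j ‖ ≡ inv j ^ 2 + ½ * inv j ^ 4 + ¼ * inv j ^ 6
‖I‖ j = ‖⟨⟩‖ (0≤^ 2 (0≤inv j)) (0≤^ 4 (0≤inv j)) (0≤^ 6 (0≤inv j))

-- With M = 1/u = k + n + 2, the norm of I times M² - ½ is 1 - u⁶/8, and (n + 1)² + 2 ≤ M² - ½.
‖quad4‖*‖I‖≤1 : ∀ n k → ‖ quad 4ℚ n ‖ * ‖ I (suc (k ℕ.+ n)) ‖ ≤ 1ℚ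
‖quad4‖*‖I‖≤1 n k = subst (_≤ 1ℚ) (sym (cong₂ _*_ (‖quad4‖ n) (‖I‖ (suc (k ℕ.+ n)))))
  (p+r≡q⇒p≤q
    (trans (lemma (ν n) (ν k) u)
    (trans (cong (λ t → t * t + (½ * u ^ 2 + ¼ * u ^ 4) * (t * t - 1ℚ)) M*u≡1)
           (lemma′ u)))
    (0≤+ (0≤* (from-yes (0ℚ ≤? ⅛)) (0≤^ 6 0≤u))
         (0≤* (0≤+ (0≤+ (0≤+ (0≤+ 0≤½ (0≤* (from-yes (0ℚ ≤? 2ℚ)) (0≤ν n)))
                                       (0≤* (from-yes (0ℚ ≤? 4ℚ)) (0≤ν k)))
                                  (0≤* (from-yes (0ℚ ≤? 2ℚ)) (0≤* (0≤ν n) (0≤ν k))))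
                             (0≤* (0≤ν k) (0≤ν k)))
              (0≤+ (0≤+ (0≤^ 2 0≤u) (0≤* 0≤½ (0≤^ 4 0≤u))) (0≤* 0≤¼ (0≤^ 6 0≤u))))))
  where
  open +-*-Solver
  u : ℚ
  u = inv (suc (k ℕ.+ n))
  0≤u : 0ℚ ≤ u
  0≤u = 0≤inv (suc (k ℕ.+ n))
  M*u≡1 : (1ℚ + (1ℚ + (ν k + ν n))) * u ≡ 1ℚ
  M*u≡1 = trans (cong (λ z → (1ℚ + (1ℚ + z)) * u) (sym (ν-+ k n))) (ν*inv (suc (k ℕ.+ n)))
  lemma : ∀ n k u →
    ((1ℚ + n) * (1ℚ + n) + 2ℚ) * (u ^ 2 + ½ * u ^ 4 + ¼ * u ^ 6)
      + (⅛ * u ^ 6 + (½ + 2ℚ * n + 4ℚ * k + 2ℚ * (n * k) + k * k) * (u ^ 2 + ½ * u ^ 4 + ¼ * u ^ 6))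
    ≡ (1ℚ + (1ℚ + (k + n))) * u * ((1ℚ + (1ℚ + (k + n))) * u)
      + (½ * u ^ 2 + ¼ * u ^ 4) * ((1ℚ + (1ℚ + (k + n))) * u * ((1ℚ + (1ℚ + (k + n))) * u) - 1ℚ)
  lemma = solve 3 (λ n k u →
    let N = u :^ 2 :+ con ½ :* u :^ 4 :+ con ¼ :* u :^ 6
        t = (con 1ℚ :+ (con 1ℚ :+ (k :+ n))) :* u
    in ((con 1ℚ :+ n) :* (con 1ℚ :+ n) :+ con 2ℚ) :* N
         :+ (con ⅛ :* u :^ 6 :+ (con ½ :+ con 2ℚ :* n :+ con 4ℚ :* k :+ con 2ℚ :* (n :* k) :+ k :* k) :* N)
    := t :* t :+ (con ½ :* u :^ 2 :+ con ¼ :* u :^ 4) :* (t :* t :- con 1ℚ)) refl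
  lemma′ : ∀ u → 1ℚ * 1ℚ + (½ * u ^ 2 + ¼ * u ^ 4) * (1ℚ * 1ℚ - 1ℚ) ≡ 1ℚ
  lemma′ = solve 1 (λ u →
    con (1ℚ * 1ℚ) :+ (con ½ :* u :^ 2 :+ con ¼ :* u :^ 4) :* con (1ℚ * 1ℚ - 1ℚ) :=
      con 1ℚ) refl

-- The ratio of consecutive terms is a scalar of norm at most ½ times a quadratic quotient of norm
-- at most 1.
‖F-suc‖ : ∀ n k → ‖ F (suc n) k ‖ ≤ ½ * ‖ F n k ‖
‖F-suc‖ n k = begin
  ‖ F n k *ⱼ (ι v *ⱼ ι (d n) *ⱼ q) *ⱼ i ‖
    ≡⟨ cong ‖_‖ (regroup (F n k) (ι v) (ι (d n)) q i) ⟩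
  ‖ F n k *ⱼ (ι v *ⱼ ι (d n)) *ⱼ (q *ⱼ i) ‖
    ≤⟨ ‖p*q‖≤‖p‖*‖q‖ (F n k *ⱼ (ι v *ⱼ ι (d n))) (q *ⱼ i) ⟩
  ‖ F n k *ⱼ (ι v *ⱼ ι (d n)) ‖ * ‖ q *ⱼ i ‖
    ≤⟨ *-mono-≤ 0≤‖ q *ⱼ i ‖ (0≤* 0≤‖ F n k ‖ 0≤½) left right ⟩
  ‖ F n k ‖ * ½ * 1ℚ
    ≡⟨ solve 1 (λ x → x :* con ½ :* con 1ℚ := con ½ :* x) refl (‖ F n k ‖) ⟩
  ½ * ‖ F n k ‖                                           ∎
  where
  open ≤-Reasoning
  open +-*-Solver
  regroup : ∀ f v D q i → f *ⱼ (v *ⱼ D *ⱼ q) *ⱼ i ≡ f *ⱼ (v *ⱼ D) *ⱼ (q *ⱼ i)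
  regroup = J.solve 5 (λ f v D q i →
    f J.:* (v J.:* D J.:* q) J.:* i J.:= f J.:* (v J.:* D) J.:* (q J.:* i)) refl
    where module J = JetSolver
  v : ℚ
  v = ν (suc n)
  q i : Jet
  q = quad 4ℚ n
  i = I (suc (k ℕ.+ n))
  right : ‖ q *ⱼ i ‖ ≤ 1ℚ
  right = ≤-trans (‖p*q‖≤‖p‖*‖q‖ q i) (‖quad4‖*‖I‖≤1 n k)
  left : ‖ F n k *ⱼ (ι v *ⱼ ι (d n)) ‖ ≤ ‖ F n k ‖ * ½
  left = ≤-trans (‖p*q‖≤‖p‖*‖q‖ (F n k) (ι v *ⱼ ι (d n)))
    (*-monoˡ-≤-nonNeg (‖ F n k ‖) {{nonNegative 0≤‖ F n k ‖}}
      (≤-trans (≤-reflexive (trans (cong ‖_‖ (ι-* v (d n))) (‖ι‖ (0≤* (0≤ν (suc n)) (0≤d n))))) (n*d≤½ n)))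

-- As u ≤ 1, the norm is at most (1 + ½ + ¼) u²; the slack is written with the factor 1 - u.
‖I‖≤ : ∀ j → ‖ I j ‖ ≤ 2ℚ * inv j ^ 2
‖I‖≤ j = subst (_≤ 2ℚ * u ^ 2) (sym (‖I‖ j)) (p+r≡q⇒p≤q
    (solve 1 (λ u → u :^ 2 :+ con ½ :* u :^ 4 :+ con ¼ :* u :^ 6
        :+ (u :^ 2 :* ((con 1ℚ :- u) :*
             (con ½ :* (con 1ℚ :+ u) :+ con ¼ :* ((con 1ℚ :+ u) :* (con 1ℚ :+ u :^ 2))) :+ con ¼))
      := con 2ℚ :* u :^ 2) refl u)
    (0≤* (0≤^ 2 0≤u) (0≤+ (0≤* (p≤q⇒0≤q-p (inv-anti {0} {j} ℕ.z≤n))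
       (0≤+ (0≤* 0≤½ 0≤1+u) (0≤* 0≤¼ (0≤* 0≤1+u (0≤+ 0≤1 (0≤^ 2 0≤u)))))) 0≤¼)))
  where
  open +-*-Solver
  u : ℚ
  u = inv j
  0≤u : 0ℚ ≤ u
  0≤u = 0≤inv j
  0≤1+u : 0ℚ ≤ 1ℚ + u
  0≤1+u = 0≤+ 0≤1 0≤u

‖F‖≤ : ∀ n k → ‖ F n k ‖ ≤ ½ ^ n * (2ℚ * inv k ^ 2)
‖F‖≤ zero    k = ≤-trans (‖I‖≤ k) (≤-reflexive (sym (*-identityˡ (2ℚ * inv k ^ 2))))
‖F‖≤ (suc n) k = ≤-trans (‖F-suc‖ n k) (≤-trans (*-monoˡ-≤-nonNeg ½ (‖F‖≤ n k))
  (≤-reflexive (sym (*-assoc ½ (½ ^ n) (2ℚ * inv k ^ 2)))))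

0≤½^ : ∀ n → 0ℚ ≤ ½ ^ n
0≤½^ n = 0≤^ n 0≤½

‖∑F‖≤ : ∀ n K → ‖ ∑ (F n) K ‖ ≤ ½ ^ n * (2ℚ * H 2 K)
‖∑F‖≤ n zero    = ≤-reflexive (sym (*-zeroʳ (½ ^ n)))
‖∑F‖≤ n (suc K) = begin
  ‖ ∑ (F n) K +ⱼ F n K ‖                                 ≤⟨ ‖p+q‖≤‖p‖+‖q‖ (∑ (F n) K) (F n K) ⟩
  ‖ ∑ (F n) K ‖ + ‖ F n K ‖                              ≤⟨ +-mono-≤ (‖∑F‖≤ n K) (‖F‖≤ n K) ⟩
  ½ ^ n * (2ℚ * H 2 K) + ½ ^ n * (2ℚ * inv K ^ 2)
    ≡⟨ solve 3 (λ a b c → a :* (con 2ℚ :* b) :+ a :* (con 2ℚ :* c) :=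
        a :* (con 2ℚ :* (b :+ c))) refl (½ ^ n) (H 2 K) (inv K ^ 2) ⟩
  ½ ^ n * (2ℚ * (H 2 K + inv K ^ 2))
    ≡⟨ cong (λ z → ½ ^ n * (2ℚ * (H 2 K + z))) (recip-^ K 2) ⟨
  ½ ^ n * (2ℚ * H 2 (suc K))                             ∎
  where
  open ≤-Reasoning
  open +-*-Solver

-- The multiplier in `G` is at most 2 (K + 1), which consumes one of the two factors 1 / (K + 1) in
-- the bound for `F`. The slack in `lemma` is 4 (1 + κ) (1 + 2m) - (3 (1 + m) + 2κ) = 1 + 5m + 2κ +
-- 8mκ.
‖G‖≤ : ∀ m K → ‖ G m K ‖ ≤ ½ ^ m * (4ℚ * inv K)
‖G‖≤ m K = begin
  ‖ F m K *ⱼ ((3ⱼ *ⱼ ι v +ⱼ 2ⱼ *ⱼ ι κ) *ⱼ ι (d m)) ‖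
    ≡⟨ cong (λ z → ‖ F m K *ⱼ z ‖) (trans
         (cong (_*ⱼ ι (d m)) (cong₂ _+ⱼ_ (ι-* 3ℚ v) (ι-* 2ℚ κ)))
         (ι-* (3ℚ * v + 2ℚ * κ) (d m))) ⟩
  ‖ F m K *ⱼ ι g ‖                                     ≤⟨ ‖p*q‖≤‖p‖*‖q‖ (F m K) (ι g) ⟩
  ‖ F m K ‖ * ‖ ι g ‖                                  ≡⟨ cong (‖ F m K ‖ *_) (‖ι‖ 0≤g) ⟩
  ‖ F m K ‖ * g
    ≤⟨ *-monoʳ-≤-nonNeg g {{nonNegative 0≤g}} (‖F‖≤ m K) ⟩
  ½ ^ m * (2ℚ * u ^ 2) * g                             ≡⟨ *-assoc (½ ^ m) (2ℚ * u ^ 2) g ⟩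
  ½ ^ m * (2ℚ * u ^ 2 * g)
    ≤⟨ *-monoˡ-≤-nonNeg (½ ^ m) {{nonNegative (0≤½^ m)}} bound ⟩
  ½ ^ m * (4ℚ * u)                                     ∎
  where
  open ≤-Reasoning
  open +-*-Solver
  v κ u D g : ℚ
  v = ν (suc m)
  κ = ν K
  u = inv K
  D = d m
  g = (3ℚ * v + 2ℚ * κ) * D
  0≤g : 0ℚ ≤ g
  0≤g = 0≤* (0≤+ (0≤* (from-yes (0ℚ ≤? 3ℚ)) (0≤ν (suc m))) (0≤* (from-yes (0ℚ ≤? 2ℚ)) (0≤ν K))) (0≤d m)
  lemma : ∀ m κ u D → 2ℚ * u ^ 2 * ((3ℚ * (1ℚ + m) + 2ℚ * κ) * D)
      + 2ℚ * u ^ 2 * ((1ℚ + ((4ℚ + 1ℚ) * m + (2ℚ * κ + 4ℚ * (2ℚ * (m * κ))))) * D)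
      ≡ 4ℚ * u * ((1ℚ + κ) * u) * (2ℚ * (1ℚ + 2ℚ * m) * D)
  lemma = solve 4 (λ m κ u D → con 2ℚ :* u :^ 2 :* ((con 3ℚ :* (con 1ℚ :+ m) :+ con 2ℚ :* κ) :* D)
      :+ con 2ℚ :* u :^ 2 :* ((con 1ℚ :+ ((con 4ℚ :+ con 1ℚ) :* m :+ (con 2ℚ :* κ :+ con 4ℚ :* (con 2ℚ :* (m :* κ))))) :* D)
      := con 4ℚ :* u :* ((con 1ℚ :+ κ) :* u) :* (con 2ℚ :* (con 1ℚ :+ con 2ℚ :* m) :* D)) refl
  bound : 2ℚ * u ^ 2 * g ≤ 4ℚ * u
  bound = p+r≡q⇒p≤q
    (trans (lemma (ν m) κ u D) (trans (cong₂ (λ x z → 4ℚ * u * x * z) (ν*inv K) (cong coeff₀ (d-inverse m)))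
      (solve 1 (λ x → x :* con 1ℚ :* con 1ℚ := x) refl (4ℚ * u))))
    (0≤* (0≤* (from-yes (0ℚ ≤? 2ℚ)) (0≤^ 2 (0≤inv K)))
         (0≤* (0≤+ 0≤1 (0≤+ (0≤* (from-yes (0ℚ ≤? 4ℚ + 1ℚ)) (0≤ν m)) (0≤+ (0≤* (from-yes (0ℚ ≤? 2ℚ)) (0≤ν K))
           (0≤* (from-yes (0ℚ ≤? 4ℚ)) (0≤* (from-yes (0ℚ ≤? 2ℚ)) (0≤* (0≤ν m) (0≤ν K))))))) (0≤d m)))

-- The geometric sum is kept exact, since the constant 2 alone would not survive the induction.
‖∑G‖≤ : ∀ n K → ‖ ∑ (λ m → G m K) n ‖ ≤ (2ℚ - 2ℚ * ½ ^ n) * (4ℚ * inv K)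
‖∑G‖≤ zero    K = ≤-reflexive (sym (*-zeroˡ (4ℚ * inv K)))
‖∑G‖≤ (suc n) K = begin
  ‖ ∑ (λ m → G m K) n +ⱼ G n K ‖          ≤⟨ ‖p+q‖≤‖p‖+‖q‖ (∑ (λ m → G m K) n) (G n K) ⟩
  ‖ ∑ (λ m → G m K) n ‖ + ‖ G n K ‖       ≤⟨ +-mono-≤ (‖∑G‖≤ n K) (‖G‖≤ n K) ⟩
  (2ℚ - 2ℚ * ½ ^ n) * (4ℚ * inv K) + ½ ^ n * (4ℚ * inv K)
    ≡⟨ solve 2 (λ h x → (con 2ℚ :- con 2ℚ :* h) :* x :+ h :* x :=
        (con 2ℚ :- con 2ℚ :* (con ½ :* h)) :* x) refl (½ ^ n) (4ℚ * inv K) ⟩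
  (2ℚ - 2ℚ * ½ ^ suc n) * (4ℚ * inv K)    ∎
  where
  open ≤-Reasoning
  open +-*-Solver

-- Trades geometric decay for the rate 1 / (n + 1), which `archimedean` can make small. The step
-- uses n + 2 ≤ 2 (n + 1).
½^n≤inv : ∀ n → ½ ^ n ≤ inv n
½^n≤inv zero    = ≤-refl
½^n≤inv (suc n) = ≤-trans (*-monoˡ-≤-nonNeg ½ (½^n≤inv n)) (p+r≡q⇒p≤q
  (begin
    ½ * u + r
      ≡⟨ solve 2 (λ u r → con ½ :* u :+ r := con ½ :* u :* con 1ℚ :+ r) refl u r ⟩
    ½ * u * 1ℚ + r                               ≡⟨ cong (λ z → ½ * u * z + r) (ν*inv (suc n)) ⟨
    ½ * u * (ν (suc (suc n)) * u′) + r           ≡⟨ lemma (ν n) u u′ ⟩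
    u′ * (ν (suc n) * u)                         ≡⟨ cong (u′ *_) (ν*inv n) ⟩
    u′ * 1ℚ                                      ≡⟨ *-identityʳ u′ ⟩
    u′                                           ∎)
  (0≤* 0≤½ (0≤* (0≤ν n) (0≤* (0≤inv n) (0≤inv (suc n))))))
  where
  open ≡-Reasoning
  open +-*-Solver
  u u′ r : ℚ
  u = inv n
  u′ = inv (suc n)
  r = ½ * (ν n * (u * u′))
  lemma : ∀ n u u′ →
    ½ * u * ((1ℚ + (1ℚ + n)) * u′) + ½ * (n * (u * u′)) ≡ u′ * ((1ℚ + n) * u)
  lemma = solve 3 (λ n u u′ →
    con ½ :* u :* ((con 1ℚ :+ (con 1ℚ :+ n)) :* u′) :+ con ½ :* (n :* (u :* u′)) :=
    u′ :* ((con 1ℚ :+ n) :* u)) refl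

-- With n = m + 1 the norm is D (n + 3 / (2n)) while ½ = D (2n + 1), and 3 / (2n) ≤ 3/2 < n + 1.
‖T‖≤½ : ∀ m → ‖ T m ‖ ≤ ½
‖T‖≤½ m = begin
  ‖ T m ‖                                     ≡⟨ cong ‖_‖ (trans (T-≡ m) (cong (_*ⱼ t) (ι-* v D))) ⟩
  ‖ ι (v * D) *ⱼ t ‖                          ≤⟨ ‖p*q‖≤‖p‖*‖q‖ (ι (v * D)) t ⟩
  ‖ ι (v * D) ‖ * ‖ t ‖
    ≡⟨ cong₂ _*_ (‖ι‖ (0≤* (0≤ν (suc m)) (0≤d (suc m)))) t-≡ ⟩
  v * D * (1ℚ + ½ * (3ℚ * u ^ 2) + ¼ * 0ℚ)    ≤⟨ p+r≡q⇒p≤q (trans (lemma (ν m) u D)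
      (trans (cong₂ (λ x z → ½ * x + 3ℚ * ½ * u * D * (z - 1ℚ)) (cong coeff₀ (d-inverse (suc m))) (ν*inv m))
             (solve 1 (λ a → con (½ * 1ℚ) :+ a :* con (1ℚ - 1ℚ) := con ½) refl (3ℚ * ½ * u * D))))
      (0≤* (0≤d (suc m)) (0≤+ (0≤+ 0≤½ (0≤ν m))
                              (0≤* (from-yes (0ℚ ≤? 3ℚ * ½)) (p≤q⇒0≤q-p (inv-anti {0} {m} ℕ.z≤n))))) ⟩
  ½                                           ∎
  where
  open ≤-Reasoning
  open +-*-Solver
  v u D : ℚ
  v = ν (suc m)
  u = inv m
  D = d (suc m)
  t : Jet
  t = ⟨ 1ℚ , - (3ℚ * u ^ 2) , 0ℚ ⟩
  t-≡ : ‖ t ‖ ≡ 1ℚ + ½ * (3ℚ * u ^ 2) + ¼ * 0ℚ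
  t-≡ = cong (λ z → 1ℚ + ½ * z + ¼ * 0ℚ) (trans
    (∣-p∣≡∣p∣ (3ℚ * u ^ 2))
    (0≤p⇒∣p∣≡p (0≤* (from-yes (0ℚ ≤? 3ℚ)) (0≤^ 2 (0≤inv m)))))
  lemma : ∀ m u D →
    (1ℚ + m) * D * (1ℚ + ½ * (3ℚ * u ^ 2) + ¼ * 0ℚ) + D * (½ + m + 3ℚ * ½ * (1ℚ - u))
    ≡ ½ * (2ℚ * (1ℚ + 2ℚ * (1ℚ + m)) * D) + 3ℚ * ½ * u * D * ((1ℚ + m) * u - 1ℚ)
  lemma = solve 3 (λ m u D →
    (con 1ℚ :+ m) :* D :* (con 1ℚ :+ con ½ :* (con 3ℚ :* u :^ 2) :+ con (¼ * 0ℚ)) :+ D :* (con ½ :+ m :+ con (3ℚ * ½) :* (con 1ℚ :- u))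
    :=
       con ½ :* (con 2ℚ :* (con 1ℚ :+ con 2ℚ :* (con 1ℚ :+ m)) :* D) :+ con (3ℚ * ½) :* u :* D :* ((con 1ℚ :+ m) :* u :- con 1ℚ)) refl

‖P‖≤ : ∀ m → ‖ P m ‖ ≤ ½ ^ m
‖P‖≤ zero    = ≤-refl
‖P‖≤ (suc m) = ≤-trans (‖p*q‖≤‖p‖*‖q‖ (P m) (T m)) (≤-trans
  (*-mono-≤ 0≤‖ T m ‖ (0≤½^ m) (‖P‖≤ m) (‖T‖≤½ m))
  (≤-reflexive (*-comm (½ ^ m) ½)))

-- Error bound and convergence

S : ℕ → Jet
S = ∑ (λ m → P m *ⱼ V m)

S-≡ : ∀ n → S n ≡ ∑ (λ m → G m 0) n
S-≡ zero    = refl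
S-≡ (suc n) = cong₂ _+ⱼ_ (S-≡ n) (P*V≡G n)

8ℚ 32ℚ : ℚ
8ℚ = + 8 / 1
32ℚ = + 32 / 1

-- By `∑-closed` the difference equals the two far edges of the rectangle; the `G` edge is small in
-- K and the `F` edge in n.
‖S-∑I‖≤ : ∀ n K → ‖ S n -ⱼ ∑ I K ‖ ≤ 8ℚ * (inv n + inv K)
‖S-∑I‖≤ n K = begin
  ‖ S n -ⱼ ∑ I K ‖                                   ≡⟨ cong ‖_‖ difference ⟩
  ‖ ∑ (λ m → G m K) n -ⱼ ∑ (F n) K ‖
    ≤⟨ ‖p+q‖≤‖p‖+‖q‖ (∑ (λ m → G m K) n) (negⱼ (∑ (F n) K)) ⟩
  ‖ ∑ (λ m → G m K) n ‖ + ‖ negⱼ (∑ (F n) K) ‖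
    ≡⟨ cong (λ z → ‖ ∑ (λ m → G m K) n ‖ + z) (‖neg‖ (∑ (F n) K)) ⟩
  ‖ ∑ (λ m → G m K) n ‖ + ‖ ∑ (F n) K ‖              ≤⟨ +-mono-≤ (‖∑G‖≤ n K) (‖∑F‖≤ n K) ⟩
  (2ℚ - 2ℚ * ½ ^ n) * (4ℚ * inv K) + ½ ^ n * (2ℚ * H 2 K)
    ≤⟨ +-mono-≤ g≤ f≤ ⟩
  8ℚ * inv K + 8ℚ * inv n
    ≡⟨ solve 2 (λ a b → con 8ℚ :* a :+ con 8ℚ :* b := con 8ℚ :* (b :+ a)) refl (inv K) (inv n) ⟩
  8ℚ * (inv n + inv K)                               ∎
  where
  open ≤-Reasoning
  open +-*-Solver
  difference : S n -ⱼ ∑ I K ≡ ∑ (λ m → G m K) n -ⱼ ∑ (F n) K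
  difference = trans (cong (_-ⱼ ∑ I K) (S-≡ n))
    (move (∑ (F n) K) (∑ (λ m → G m 0) n) (∑ I K) (∑ (λ m → G m K) n) (∑-closed n K))
    where
    module JS = JetSolver
    move : ∀ a b c d → a +ⱼ b ≡ c +ⱼ d → b -ⱼ c ≡ d -ⱼ a
    move a b c d e = trans
      (JS.solve 3 (λ a b c → b JS.:- c JS.:= a JS.:+ b JS.:- a JS.:- c) refl a b c)
      (trans (cong (λ z → z -ⱼ a -ⱼ c) e)
      (JS.solve 3 (λ a c d → c JS.:+ d JS.:- a JS.:- c JS.:= d JS.:- a) refl a c d))
  g≤ : (2ℚ - 2ℚ * ½ ^ n) * (4ℚ * inv K) ≤ 8ℚ * inv K
  g≤ = p+r≡q⇒p≤q (solve 2 (λ h u → (con 2ℚ :- con 2ℚ :* h) :* (con 4ℚ :* u) :+ con 8ℚ :* (h :* u) :=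
      con 8ℚ :* u) refl (½ ^ n) (inv K))
    (0≤* (from-yes (0ℚ ≤? 8ℚ)) (0≤* (0≤½^ n) (0≤inv K)))
  f≤ : ½ ^ n * (2ℚ * H 2 K) ≤ 8ℚ * inv n
  f≤ = ≤-trans (*-mono-≤ (0≤* (from-yes (0ℚ ≤? 2ℚ)) (H-mono 2 {0} {K} ℕ.z≤n)) (0≤inv n) (½^n≤inv n)
         -- `U 2 0` is 2, an upper bound for all partial sums of ζ(2).
         (≤-trans (*-monoˡ-≤-nonNeg 2ℚ (H≤U 2 0 K)) (from-yes (2ℚ * U 2 0 ≤? 8ℚ))))
       (≤-reflexive (*-comm (inv n) 8ℚ))

-- The two indices are independent: for fixed m, letting K run bounds the distance to the real
-- number x itself.
⟶-from-bound : ∀ (a : ℕ → ℚ) x → (∀ m K → ∣ a m - seq x K ∣ ≤ 32ℚ * (inv m + inv K)) →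
               (λ m → fromℚ (a m)) ⟶ x
⟶-from-bound a x bound ε (δ , 0<δ , N , h) = k , λ m k≤m → ½ * δ , half-pos 0<δ , N ℕ.⊔ k , λ K N⊔k≤K →
  let open ≤-Reasoning in begin
  ∣ a m - seq x K ∣ + ½ * δ             ≤⟨ +-monoˡ-≤ (½ * δ) (bound m K) ⟩
  32ℚ * (inv m + inv K) + ½ * δ         ≤⟨ +-monoˡ-≤ (½ * δ) (*-monoˡ-≤-nonNeg 32ℚ (+-mono-≤
                                             (≤-trans (inv-anti k≤m) (<⇒≤ inv-k<))
                                             (≤-trans (inv-anti (ℕ.m⊔n≤o⇒n≤o N k N⊔k≤K)) (<⇒≤ inv-k<)))) ⟩
  32ℚ * (c * δ + c * δ) + ½ * δ
    ≡⟨ solve 1 (λ δ → con 32ℚ :* (con c :* δ :+ con c :* δ) :+ con ½ :* δ := con 0ℚ :+ δ) refl δ ⟩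
  0ℚ + δ                                ≤⟨ h K (ℕ.m⊔n≤o⇒m≤o N k N⊔k≤K) ⟩
  seq ε K                               ∎
  where
  open +-*-Solver
  c : ℚ
  -- Chosen so that 32 (c + c) = ½; the other half of δ is the positive gap demanded by `_<ᵣ_`.
  c = + 1 / 128
  small : ∃[ k ] inv k < c * δ
  small = archimedean (c * δ) (positive⁻¹ (c * δ) {{pos*pos⇒pos c δ {{positive 0<δ}}}})
  k : ℕ
  k = proj₁ small
  inv-k< : inv k < c * δ
  inv-k< = proj₂ small

theorem6p3 : ∏∞ factor ≈ limit
theorem6p3 i j = ⟶-from-bound (λ m → partialProduct factor m i j) (limit i j) λ m K →
  subst (λ q → ∣ q - seq (limit i j) K ∣ ≤ 32ℚ * (inv m + inv K))
    (sym (partialProduct-≡ m i j)) (bound m K i j)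
  where
  open +-*-Solver
  -- For the entries where the product and the limit are the same constant, so that the distance
  -- computes to 0ℚ.
  0≤rhs : ∀ m K → 0ℚ ≤ 32ℚ * (inv m + inv K)
  0≤rhs m K = 0≤* (from-yes (0ℚ ≤? 32ℚ)) (0≤+ (0≤inv m) (0≤inv K))

  vanishing : ∀ q m K → ∣ q ∣ ≤ 4ℚ * ‖ P m ‖ → ∣ q - 0ℚ ∣ ≤ 32ℚ * (inv m + inv K)
  vanishing q m K q≤ = begin
    ∣ q - 0ℚ ∣               ≡⟨ cong ∣_∣ (+-identityʳ q) ⟩
    ∣ q ∣                    ≤⟨ q≤ ⟩
    4ℚ * ‖ P m ‖             ≤⟨ *-monoˡ-≤-nonNeg 4ℚ (≤-trans (‖P‖≤ m) (½^n≤inv m)) ⟩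
    4ℚ * inv m
      ≤⟨ p+r≡q⇒p≤q (solve 2 (λ a b → con 4ℚ :* a :+ (con (32ℚ - 4ℚ) :* a :+ con 32ℚ :* b) :=
          con 32ℚ :* (a :+ b)) refl (inv m) (inv K))
                                 (0≤+ (0≤* (from-yes (0ℚ ≤? 32ℚ - 4ℚ)) (0≤inv m)) (0≤* (from-yes (0ℚ ≤? 32ℚ)) (0≤inv K))) ⟩
    32ℚ * (inv m + inv K)    ∎
    where open ≤-Reasoning

  zeta : ∀ m K (coeff : Jet → ℚ) → (∀ p → ∣ coeff p ∣ ≤ 4ℚ * ‖ p ‖) →
         ∣ coeff (S m -ⱼ ⟨ H 2 K , H 4 K , H 6 K ⟩) ∣ ≤ 32ℚ * (inv m + inv K)
  zeta m K coeff coeff≤ = begin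
    ∣ coeff (S m -ⱼ ⟨ H 2 K , H 4 K , H 6 K ⟩) ∣   ≡⟨ cong (λ z → ∣ coeff (S m -ⱼ z) ∣) (∑I≡H K) ⟨
    ∣ coeff (S m -ⱼ ∑ I K) ∣                       ≤⟨ coeff≤ (S m -ⱼ ∑ I K) ⟩
    4ℚ * ‖ S m -ⱼ ∑ I K ‖                          ≤⟨ *-monoˡ-≤-nonNeg 4ℚ (‖S-∑I‖≤ m K) ⟩
    4ℚ * (8ℚ * (inv m + inv K))                    ≡⟨ *-assoc 4ℚ 8ℚ (inv m + inv K) ⟨
    32ℚ * (inv m + inv K)                          ∎
    where open ≤-Reasoning

  bound : ∀ m K i j → ∣ toeplitz (P m) (S m) i j - seq (limit i j) K ∣ ≤ 32ℚ * (inv m + inv K)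
  -- Rows 0, 1, 2 of the last column hold the coefficients of y², y, 1, hence ζ(6), ζ(4), ζ(2).
  bound m K = λ where
    0F 0F → vanishing _ m K (coeff₀≤ (P m))
    0F 1F → vanishing _ m K (coeff₁≤ (P m))
    0F 2F → vanishing _ m K (coeff₂≤ (P m))
    0F 3F → zeta m K coeff₂ coeff₂≤
    1F 0F → 0≤rhs m K
    1F 1F → vanishing _ m K (coeff₀≤ (P m))
    1F 2F → vanishing _ m K (coeff₁≤ (P m))
    1F 3F → zeta m K coeff₁ coeff₁≤
    2F 0F → 0≤rhs m K
    2F 1F → 0≤rhs m K
    2F 2F → vanishing _ m K (coeff₀≤ (P m))
    2F 3F → zeta m K coeff₀ coeff₀≤
    3F 0F → 0≤rhs m K
    3F 1F → 0≤rhs m K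
    3F 2F → 0≤rhs m K
    3F 3F → 0≤rhs m K
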